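{- For all hypergraphs $G$ and $H$, the following are equivalent: (1) for every connected Berge-acyclic hypergraph $B$, $\mathsf{Hom}(B,G)=\mathsf{Hom}(B,H)$; (2) hypergraph color refinement does not distinguish $G$ and $H$.
   Context: All structures are finite. A hypergraph is a triple $G=(V,E,f)$ with $V=V(G)$ a finite set of vertices, $E=E(G)$ a finite set of edges and $f=f_G\colon E\to \mathcal{P}(V)\setminus\{\emptyset\}$ an incidence function; parallel edges (distinct edges with the same vertex set) are allowed. The incidence graph of $G$ is the bipartite graph on $V(G)\,\dot\cup\, E(G)$ with an edge $ve$ whenever $v\in f_G(e)$. $G$ is connected if its incidence graph is connected, and Berge-acyclic if its incidence graph is acyclic. A homomorphism from $F$ to $G$ is a pair $(h_V,h_E)$ of maps $h_V\colon V(F)\to V(G)$, $h_E\colon E(F)\to E(G)$ with $h_V(f_F(e))=f_G(h_E(e))$ for all $e\in E(F)$; $\mathsf{Hom}(F,G)$ is the number of homomorphisms from $F$ to $G$. Hypergraph color refinement: for a hypergraph $G$ set $c^G_0(v)=1$ for all $v\in V(G)$ and, for $i\ge 0$, $c^G_{i+1}(v)=\{\!\{\ \{\!\{ c^G_i(u) : u\in f_G(e)\}\!\}\ : e\in E(G),\ v\in f_G(e)\}\!\}$ (multisets). Color refinement distinguishes $G$ and $H$ if there is $i\ge 0$ with $\{\!\{c^G_i(v): v\in V(G)\}\!\}\neq\{\!\{c^H_i(v): v\in V(H)\}\!\}$. -}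

module Defs where

open import Data.Nat using (ℕ; zero; suc; _≤_)
open import Data.Fin using (Fin)
open import Data.Fin.Properties using (any?; all?) renaming (_≟_ to _≟ᶠ_)
open import Data.Fin.Subset using (Subset; _∈_; Nonempty)
open import Data.Fin.Subset.Properties using (_∈?_)
open import Data.Bool using (Bool)
open import Data.Bool.Properties renaming (_≟_ to _≟ᵇ_)
open import Data.Vec using (tabulate)
open import Data.Vec.Properties using (≡-dec)
open import Data.Vec.Functional as VF using ()
open import Data.List using (List; []; _∷_; [_]; _++_; length; map; concatMap; filter; cartesianProduct)
open import Data.List.Relation.Unary.Unique.Propositional using (Unique)
open import Data.Product using (Σ; _×_; _,_; proj₁; ∃)
open import Data.Sum using (_⊎_; inj₁; inj₂)
open import Data.Empty using (⊥)
open import Data.Unit using (⊤)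
open import Relation.Nullary using (Dec; does; _×-dec_)
open import Relation.Binary.PropositionalEquality using (_≡_)
open import Function.Bundles using (_⤖_; Bijection)

-- Hypergraphs: V = Fin nV, E = Fin nE, incidence inc : E → nonempty subsets of V.
-- Parallel edges are allowed (inc need not be injective).

record Hypergraph : Set where
  field
    nV  : ℕ
    nE  : ℕ
    inc : Fin nE → Subset nV
    inc-nonempty : ∀ e → Nonempty (inc e)

open Hypergraph public

image : ∀ {a b} → (Fin a → Fin b) → Subset a → Subset b
image {a} h p = tabulate (λ y → does (any? (λ x → (x ∈? p) ×-dec (h x ≟ᶠ y))))

IsHom : (F G : Hypergraph) → (Fin (nV F) → Fin (nV G)) → (Fin (nE F) → Fin (nE G)) → Set
IsHom F G hV hE = ∀ e → image hV (inc F e) ≡ inc G (hE e)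

isHom? : (F G : Hypergraph) → ∀ hV hE → Dec (IsHom F G hV hE)
isHom? F G hV hE = all? (λ e → ≡-dec _≟ᵇ_ (image hV (inc F e)) (inc G (hE e)))

allFuns : (a b : ℕ) → List (Fin a → Fin b)
allFuns zero    b = [ (λ ()) ]
allFuns (suc a) b = concatMap (λ y → map (λ g → y VF.∷ g) (allFuns a b)) (Data.List.allFin b)
  where import Data.List

Hom : Hypergraph → Hypergraph → ℕ
Hom F G = length (filter (λ p → isHom? F G (proj₁ p) (Data.Product.proj₂ p))
                         (cartesianProduct (allFuns (nV F) (nV G)) (allFuns (nE F) (nE G))))
  where import Data.Product

Node : Hypergraph → Set
Node H = Fin (nV H) ⊎ Fin (nE H)

Adj : (H : Hypergraph) → Node H → Node H → Set
Adj H (inj₁ v) (inj₂ e) = v ∈ inc H e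
Adj H (inj₂ e) (inj₁ v) = v ∈ inc H e
Adj H (inj₁ _) (inj₁ _) = ⊥
Adj H (inj₂ _) (inj₂ _) = ⊥

data Walk (H : Hypergraph) : Node H → Node H → Set where
  here : ∀ {x} → Walk H x x
  step : ∀ {x y z} → Adj H x y → Walk H y z → Walk H x z

Connected : Hypergraph → Set
Connected H = ∀ x y → Walk H x y

Chain : (H : Hypergraph) → Node H → List (Node H) → Set
Chain H x []       = ⊤
Chain H x (y ∷ ys) = Adj H x y × Chain H y ys

Cycle : Hypergraph → Set
Cycle H = Σ (Node H) λ x → Σ (List (Node H)) λ ys →
          (2 ≤ length ys) × Unique (x ∷ ys) × Chain H x (ys ++ [ x ])

BergeAcyclic : Hypergraph → Set
BergeAcyclic H = Cycle H → ⊥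

-- Multiset equality: the multiset {{ c(x) : x ∈ P }} equals {{ d(y) : y ∈ Q }}
-- where "same colour" is the relation R; i.e. a bijection between the index
-- sets matching colours.

MSetEq : ∀ {a b} → (Fin a → Set) → (Fin b → Set) → (Fin a → Fin b → Set) → Set
MSetEq {a} {b} P Q R =
  Σ (Σ (Fin a) P ⤖ Σ (Fin b) Q) λ σ → ∀ x → R (proj₁ x) (proj₁ (Bijection.to σ x))

-- SameColour i G H v w  ⟺  c^G_i(v) = c^H_i(w)
SameColour : ℕ → (G H : Hypergraph) → Fin (nV G) → Fin (nV H) → Set
SameColour zero    G H v w = ⊤
SameColour (suc i) G H v w =
  MSetEq (λ e → v ∈ inc G e) (λ e' → w ∈ inc H e')
         (λ e e' → MSetEq (λ u → u ∈ inc G e) (λ u' → u' ∈ inc H e')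
                          (SameColour i G H))

NotDistinguished : Hypergraph → Hypergraph → Set
NotDistinguished G H = ∀ i → MSetEq (λ _ → ⊤) (λ _ → ⊤) (SameColour i G H)

{-# OPTIONS --safe #-}

-- Attaching a new edge {x} ∪ {new vertices} to a hypergraph multiplies, in a vertex-weighted
-- homomorphism count, the weight at x by a function ψ of the weights of the new vertices: ψ(v)
-- sums over the edges e ∋ v and over the placements of the new vertices that cover e with v.
--
-- (2 ⇒ 1) Starting from a vertex, every connected Berge-acyclic hypergraph arises by attaching
-- edges, since an edge meeting the explored part twice would close a cycle. If the weights depend
-- only on the i-th colours then ψ depends only on the (i+1)-st, so the counts agree.
--
-- (1 ⇒ 2) The rational span of the root-to-z counts of hypertrees is an algebra of functions on
-- V(G) ⊔ V(H) closed under ψ. By induction on i it contains the indicators of the classes of a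
-- colouring at least as fine as the i-th one: applying ψ to the indicators of the classes of all
-- vertices but one of an edge e₀ counts edges of the colour type of e₀, up to a nonzero factor and
-- up to contributions of smaller edges, so the number of edges of each type at a vertex is
-- determined by induction on ∣e₀∣. Summing indicators over V(G) and V(H) compares the class sizes.
module Submission where

open import Defs
open import Algebra.Bundles using (module AbelianGroup; module CommutativeRing)
import Algebra.Properties.CommutativeMonoid.Sum
import Algebra.Properties.Group
import Algebra.Properties.Semiring.Sum
open import Data.Bool using (Bool; true; false)
open import Data.Bool.Properties using () renaming (_≟_ to _≟ᵇ_)
open import Data.Empty using (⊥-elim)
open import Data.Fin using (Fin; zero; suc; _↑ˡ_; _↑ʳ_; splitAt; join)
open import Data.Fin.Properties using (all?; any?; join-splitAt; injective⇒≤; punchInᵢ≢i) renaming (_≟_ to _≟ᶠ_; suc-injective to sucᶠ-injective)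
open import Data.Fin.Subset using (Subset; _∈_; _∉_; _⊆_; _∪_; ⁅_⁆; Nonempty; inside; outside)
open import Data.Fin.Subset.Properties
open import Data.Integer as ℤ using (ℤ; +_; 0ℤ; 1ℤ; _+_; _*_; _-_; _≤_; _<_; +≤+; +<+; _≟_)
open import Data.Integer.Properties hiding (_≟_)
open import Data.Integer.Tactic.RingSolver using (solve-∀)
open import Data.List as List using (List; []; _∷_; [_]; _++_; length; map)
open import Data.List.Membership.Propositional using () renaming (_∈_ to _∈ˡ_; _∉_ to _∉ˡ_)
open import Data.List.Membership.Propositional.Properties using (∈-++⁺ʳ; ∈-++⁻; ∈-lookup; ∈-filter⁺; ∈-filter⁻; ∈-allFin; ∈-map⁻)
open import Data.List.Properties using (++-assoc; map-++; length-++; length-map)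
open import Data.List.Relation.Unary.All as All using ([]; _∷_)
open import Data.List.Relation.Unary.All.Properties using (¬Any⇒All¬)
open import Data.List.Relation.Unary.AllPairs using ([]; _∷_)
open import Data.List.Relation.Unary.Any as Any using (Any; here; there; index)
open import Data.List.Relation.Unary.Any.Properties using (lookup-index)
open import Data.List.Relation.Unary.Unique.Propositional using (Unique)
open import Data.List.Relation.Unary.Unique.Propositional.Properties using (allFin⁺; Unique[x∷xs]⇒x∉xs)
  renaming (map⁺ to unique-map⁺; map⁻ to unique-map⁻; ++⁺ to unique-++⁺; filter⁺ to unique-filter⁺)
open import Data.Nat as ℕ using (ℕ; zero; suc)
import Data.Nat.Properties as ℕ
open import Data.Product using (Σ; ∃; ∃₂; _×_; _,_; proj₁; proj₂)
open import Data.Sum as Sum using (_⊎_; inj₁; inj₂)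
open import Data.Sum.Properties using (inj₁-injective; inj₂-injective) renaming (≡-dec to ⊎-≡-dec)
open import Data.Unit using (⊤; tt)
open import Data.Vec as Vec using (here; there)
open import Data.Vec.Functional as VF using ()
open import Data.Vec.Properties using (≡-dec; lookup⇒[]=; []=⇒lookup; lookup∘tabulate)
open import Data.Vec.Properties.WithK using ([]=-irrelevant)
open import Function using (_∘_; id)
open import Function.Bundles using (_⇔_; mk⇔; mk⤖; module Bijection)
open import Relation.Binary.PropositionalEquality hiding ([_]; J)
open import Relation.Nullary using (Dec; yes; no; does; ¬_; contradiction; _×-dec_; _⊎-dec_; ¬?)
open import Relation.Nullary.Decidable using (map′; dec-true; decidable-stable)

-- Homomorphisms preserve edges exactly, so an edge may collapse onto a smaller edge but never map
-- onto a larger one; this makes the tests triangular in the edge size. The diagonal entry is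
-- positive because the vertices of e₀ themselves are one admissible placement. Edges of the same
-- size but of another colour type contribute nothing: a contributing edge has at most as many
-- vertices as e₀ in every union of classes, and at equal size the bounds for a class and for its
-- complement force equality. The attachment identity is read in opposite directions. For (2 ⇒ 1)
-- edges are peeled off, and the colour level rises with each one; for (1 ⇒ 2) a derivation of
-- membership in the algebra is unfolded until all weights are 1 and only plain homomorphism numbers
-- remain. `SameColour` compares a vertex of G with a vertex of H only, so it is handled as a
-- relation closed under zigzags, while (1 ⇒ 2) uses equivalences on the disjoint union. Counts stay
-- in ℤ: division is replaced by a nonzero multiplier that is cancelled later.

module ∑ = Algebra.Properties.Semiring.Sum (CommutativeRing.semiring +-*-commutativeRing)
module ∏ = Algebra.Properties.CommutativeMonoid.Sum *-1-commutativeMonoid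
module ∑ℕ = Algebra.Properties.CommutativeMonoid.Sum ℕ.+-0-commutativeMonoid

open ≡-Reasoning

-- Finite sums and products

opaque
  sum prod : ∀ {n} → (Fin n → ℤ) → ℤ
  sum  = ∑.sum
  prod = ∏.sum

  sum-0 : (f : Fin 0 → ℤ) → sum f ≡ 0ℤ
  sum-0 f = refl

  sum-suc : ∀ {n} (f : Fin (suc n) → ℤ) → sum f ≡ f zero + sum (f ∘ suc)
  sum-suc f = refl

  prod-0 : (f : Fin 0 → ℤ) → prod f ≡ 1ℤ
  prod-0 f = refl

  prod-suc : ∀ {n} (f : Fin (suc n) → ℤ) → prod f ≡ f zero * prod (f ∘ suc)
  prod-suc f = refl

  sum-cong : ∀ {n} {f g : Fin n → ℤ} → (∀ x → f x ≡ g x) → sum f ≡ sum g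
  sum-cong = ∑.sum-cong-≗

  prod-cong : ∀ {n} {f g : Fin n → ℤ} → (∀ x → f x ≡ g x) → prod f ≡ prod g
  prod-cong = ∏.sum-cong-≗

  sum-+ : ∀ {n} (f g : Fin n → ℤ) → sum (λ x → f x + g x) ≡ sum f + sum g
  sum-+ = ∑.∑-distrib-+

  sum-comm : ∀ {m n} (f : Fin m → Fin n → ℤ) → sum (λ x → sum (f x)) ≡ sum (λ y → sum (λ x → f x y))
  sum-comm = ∑.∑-comm

  sum-*ˡ : ∀ {n} c (f : Fin n → ℤ) → sum (λ x → c * f x) ≡ c * sum f
  sum-*ˡ c f = sym (∑.*-distribˡ-sum c f)

  sum-*ʳ : ∀ {n} (f : Fin n → ℤ) c → sum (λ x → f x * c) ≡ sum f * c
  sum-*ʳ f c = sym (∑.*-distribʳ-sum c f)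

  sum-const-0 : ∀ n → sum {n} (λ _ → 0ℤ) ≡ 0ℤ
  sum-const-0 n = ∑.sum-replicate-zero n

fromBool : Bool → ℤ
fromBool true  = 1ℤ
fromBool false = 0ℤ

⟦_⟧ : ∀ {P : Set} → Dec P → ℤ
⟦ d ⟧ = fromBool (does d)

⟦⟧-true : ∀ {P : Set} (d : Dec P) → P → ⟦ d ⟧ ≡ 1ℤ
⟦⟧-true (yes _) _ = refl
⟦⟧-true (no ¬p) p = ⊥-elim (¬p p)

⟦⟧-false : ∀ {P : Set} (d : Dec P) → ¬ P → ⟦ d ⟧ ≡ 0ℤ
⟦⟧-false (yes p) ¬p = ⊥-elim (¬p p)
⟦⟧-false (no _)  _  = refl

⟦⟧-cong : ∀ {P Q : Set} (d : Dec P) (d′ : Dec Q) → (P → Q) → (Q → P) → ⟦ d ⟧ ≡ ⟦ d′ ⟧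
⟦⟧-cong (yes p) d′ f g = sym (⟦⟧-true d′ (f p))
⟦⟧-cong (no ¬p) d′ f g = sym (⟦⟧-false d′ (¬p ∘ g))

⟦⟧-× : ∀ {P Q R : Set} (d : Dec P) (d′ : Dec Q) (d″ : Dec R) → (P → Q × R) → (Q → R → P) →
       ⟦ d ⟧ ≡ ⟦ d′ ⟧ * ⟦ d″ ⟧
⟦⟧-× d (yes q) (yes r) f g = ⟦⟧-true d (g q r)
⟦⟧-× d (yes q) (no ¬r) f g = ⟦⟧-false d (¬r ∘ proj₂ ∘ f)
⟦⟧-× d (no ¬q) d″      f g = trans (⟦⟧-false d (¬q ∘ proj₁ ∘ f)) (sym (*-zeroˡ ⟦ d″ ⟧))

⟦⟧-nonneg : ∀ {P : Set} (d : Dec P) → 0ℤ ≤ ⟦ d ⟧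
⟦⟧-nonneg (yes _) = +≤+ ℕ.z≤n
⟦⟧-nonneg (no _)  = +≤+ ℕ.z≤n

sum-zero : ∀ {n} (f : Fin n → ℤ) → (∀ x → f x ≡ 0ℤ) → sum f ≡ 0ℤ
sum-zero {n} f f≡0 = trans (sum-cong f≡0) (sum-const-0 n)

sum-mono : ∀ {n} (f g : Fin n → ℤ) → (∀ x → f x ≤ g x) → sum f ≤ sum g
sum-mono {zero}  f g f≤g = ≤-reflexive (trans (sum-0 f) (sym (sum-0 g)))
sum-mono {suc n} f g f≤g = subst₂ _≤_ (sym (sum-suc f)) (sym (sum-suc g)) (+-mono-≤ (f≤g zero) (sum-mono (f ∘ suc) (g ∘ suc) (f≤g ∘ suc)))

sum-nonneg : ∀ {n} (f : Fin n → ℤ) → (∀ x → 0ℤ ≤ f x) → 0ℤ ≤ sum f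
sum-nonneg {n} f f≥0 = subst (_≤ sum f) (sum-const-0 n) (sum-mono (λ _ → 0ℤ) f f≥0)

sum-pos : ∀ {n} (f : Fin n → ℤ) → (∀ x → 0ℤ ≤ f x) → ∀ x → 0ℤ < f x → 0ℤ < sum f
sum-pos {suc n} f f≥0 zero    fx>0 = subst (0ℤ <_) (sym (sum-suc f)) (+-mono-<-≤ fx>0 (sum-nonneg (f ∘ suc) (f≥0 ∘ suc)))
sum-pos {suc n} f f≥0 (suc x) fx>0 = subst (0ℤ <_) (sym (sum-suc f)) (+-mono-≤-< (f≥0 zero) (sum-pos (f ∘ suc) (f≥0 ∘ suc) x fx>0))

sum-unique : ∀ {n} {D : Fin n → Set} (D? : ∀ x → Dec (D x)) x → D x → (∀ y → D y → y ≡ x) →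
             sum (λ y → ⟦ D? y ⟧) ≡ 1ℤ
sum-unique D? zero    dx u = trans (sum-suc _) (cong₂ _+_ (⟦⟧-true (D? zero) dx)
  (sum-zero _ λ y → ⟦⟧-false (D? (suc y)) λ dy → contradiction (u (suc y) dy) λ ()))
sum-unique D? (suc x) dx u = trans (sum-suc _) (cong₂ _+_ (⟦⟧-false (D? zero) λ d0 → contradiction (u zero d0) λ ())
  (sum-unique (D? ∘ suc) x dx λ y dy → sucᶠ-injective (u (suc y) dy)))

sum-delta : ∀ {n} x (f : Fin n → ℤ) → sum (λ y → ⟦ y ≟ᶠ x ⟧ * f y) ≡ f x
sum-delta {n} x f = begin
  sum (λ y → ⟦ y ≟ᶠ x ⟧ * f y)  ≡⟨ sum-cong (λ y → lemma y (y ≟ᶠ x)) ⟩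
  sum (λ y → ⟦ y ≟ᶠ x ⟧ * f x)  ≡⟨ sum-*ʳ (λ y → ⟦ y ≟ᶠ x ⟧) (f x) ⟩
  sum (λ y → ⟦ y ≟ᶠ x ⟧) * f x  ≡⟨ cong (_* f x) (sum-unique (_≟ᶠ x) x refl (λ _ e → e)) ⟩
  1ℤ * f x                      ≡⟨ *-identityˡ (f x) ⟩
  f x ∎
  where
  lemma : ∀ y (d : Dec (y ≡ x)) → ⟦ d ⟧ * f y ≡ ⟦ d ⟧ * f x
  lemma y (yes refl) = refl
  lemma y (no _)     = refl

-- Double counting over the graph of a partial bijection T.
sum-match : ∀ {a b} {T : Fin a → Fin b → Set} (T? : ∀ x y → Dec (T x y)) →
            (∀ {x y y′} → T x y → T x y′ → y ≡ y′) → (∀ {x x′ y} → T x y → T x′ y → x ≡ x′) →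
            (f : Fin a → ℤ) (g : Fin b → ℤ) → (∀ {x y} → T x y → f x ≡ g y) →
            (∀ x → f x ≡ 0ℤ ⊎ ∃ λ y → T x y) → (∀ y → g y ≡ 0ℤ ⊎ ∃ λ x → T x y) →
            sum f ≡ sum g
sum-match {T = T} T? fun inj f g f≡g totˡ totʳ = begin
  sum f                                       ≡⟨ sum-cong expandˡ ⟩
  sum (λ x → sum (λ y → ⟦ T? x y ⟧ * f x))    ≡⟨ sum-comm (λ x y → ⟦ T? x y ⟧ * f x) ⟩
  sum (λ y → sum (λ x → ⟦ T? x y ⟧ * f x))    ≡⟨ sum-cong (λ y → sum-cong (λ x → swap x y (T? x y))) ⟩
  sum (λ y → sum (λ x → ⟦ T? x y ⟧ * g y))    ≡⟨ sum-cong expandʳ ⟨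
  sum g ∎
  where
  swap : ∀ x y (d : Dec (T x y)) → ⟦ d ⟧ * f x ≡ ⟦ d ⟧ * g y
  swap x y (yes t) = cong (1ℤ *_) (f≡g t)
  swap x y (no _)  = refl
  weigh : ∀ {n} (c : Fin n → ℤ) w → w ≡ 0ℤ ⊎ sum c ≡ 1ℤ → w ≡ sum (λ y → c y * w)
  weigh c w (inj₁ refl) = sym (sum-zero _ (λ y → *-zeroʳ (c y)))
  weigh c w (inj₂ eq)   = sym (trans (sum-*ʳ c w) (trans (cong (_* w) eq) (*-identityˡ w)))
  expandˡ : ∀ x → f x ≡ sum (λ y → ⟦ T? x y ⟧ * f x)
  expandˡ x = weigh _ (f x) (Sum.map₂ (λ (y , t) → sum-unique (T? x) y t (λ _ t′ → fun t′ t)) (totˡ x))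
  expandʳ : ∀ y → g y ≡ sum (λ x → ⟦ T? x y ⟧ * g y)
  expandʳ y = weigh _ (g y) (Sum.map₂ (λ (x , t) → sum-unique (λ x → T? x y) x t (λ _ t′ → inj t′ t)) (totʳ y))

-- Runs through the maps in the order in which `allFuns` lists them, so that the two can be compared
-- by induction on n.
sumF : ∀ n {m} → ((Fin n → Fin m) → ℤ) → ℤ
sumF zero    F = F (λ ())
sumF (suc n) F = sum (λ y → sumF n (λ g → F (y VF.∷ g)))

sumF-cong : ∀ n {m} {F G : (Fin n → Fin m) → ℤ} → (∀ h → F h ≡ G h) → sumF n F ≡ sumF n G
sumF-cong zero    eq = eq _
sumF-cong (suc n) eq = sum-cong (λ y → sumF-cong n (λ g → eq (y VF.∷ g)))

sumF-+ : ∀ n {m} (F G : (Fin n → Fin m) → ℤ) → sumF n (λ h → F h + G h) ≡ sumF n F + sumF n G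
sumF-+ zero    F G = refl
sumF-+ (suc n) F G = trans (sum-cong (λ y → sumF-+ n (λ g → F (y VF.∷ g)) (λ g → G (y VF.∷ g)))) (sum-+ _ _)

sumF-*ˡ : ∀ n {m} c (F : (Fin n → Fin m) → ℤ) → sumF n (λ h → c * F h) ≡ c * sumF n F
sumF-*ˡ zero    c F = refl
sumF-*ˡ (suc n) c F = trans (sum-cong (λ y → sumF-*ˡ n c (λ g → F (y VF.∷ g)))) (sum-*ˡ c _)

sumF-sum : ∀ n {m k} (F : (Fin n → Fin m) → Fin k → ℤ) →
           sumF n (λ h → sum (F h)) ≡ sum (λ y → sumF n (λ h → F h y))
sumF-sum zero    F = refl
sumF-sum (suc n) F = trans (sum-cong (λ y → sumF-sum n (λ g → F (y VF.∷ g)))) (sum-comm _)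

sumF-comm : ∀ n {m} n′ {m′} (F : (Fin n → Fin m) → (Fin n′ → Fin m′) → ℤ) →
            sumF n (λ h → sumF n′ (F h)) ≡ sumF n′ (λ h′ → sumF n (λ h → F h h′))
sumF-comm zero    n′ F = refl
sumF-comm (suc n) n′ F = trans (sum-cong (λ y → sumF-comm n n′ (λ g → F (y VF.∷ g)))) (sym (sumF-sum n′ _))

_≗?_ : ∀ {n m} (h k : Fin n → Fin m) → Dec (∀ x → h x ≡ k x)
h ≗? k = all? (λ x → h x ≟ᶠ k x)

-- Maps that agree pointwise need not be equal, so this invariance is assumed wherever a map is
-- replaced by a reassembled copy of itself.
Ext : ∀ {n m} → ((Fin n → Fin m) → ℤ) → Set
Ext F = ∀ {h k} → (∀ x → h x ≡ k x) → F h ≡ F k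

sumF-delta : ∀ n {m} k (F : (Fin n → Fin m) → ℤ) → Ext F → sumF n (λ h → ⟦ h ≗? k ⟧ * F h) ≡ F k
sumF-delta zero    k F ext = trans (*-identityˡ (F (λ ()))) (ext (λ ()))
sumF-delta (suc n) k F ext = begin
  sum (λ y → sumF n (λ g → ⟦ (y VF.∷ g) ≗? k ⟧ * F (y VF.∷ g)))
    ≡⟨ sum-cong (λ y → trans (sumF-cong n (split y)) (sumF-*ˡ n ⟦ y ≟ᶠ k zero ⟧ (λ g → ⟦ g ≗? (k ∘ suc) ⟧ * F (y VF.∷ g)))) ⟩
  sum (λ y → ⟦ y ≟ᶠ k zero ⟧ * sumF n (λ g → ⟦ g ≗? (k ∘ suc) ⟧ * F (y VF.∷ g)))
    ≡⟨ sum-cong (λ y → cong (⟦ y ≟ᶠ k zero ⟧ *_) (sumF-delta n (k ∘ suc) _ (λ e → ext λ { zero → refl ; (suc x) → e x }))) ⟩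
  sum (λ y → ⟦ y ≟ᶠ k zero ⟧ * F (y VF.∷ (k ∘ suc)))
    ≡⟨ sum-delta (k zero) _ ⟩
  F (k zero VF.∷ (k ∘ suc))
    ≡⟨ ext (λ { zero → refl ; (suc x) → refl }) ⟩
  F k ∎
  where
  split : ∀ y g → ⟦ (y VF.∷ g) ≗? k ⟧ * F (y VF.∷ g) ≡ ⟦ y ≟ᶠ k zero ⟧ * (⟦ g ≗? (k ∘ suc) ⟧ * F (y VF.∷ g))
  split y g = trans
    (cong (_* F (y VF.∷ g)) (⟦⟧-× ((y VF.∷ g) ≗? k) (y ≟ᶠ k zero) (g ≗? (k ∘ suc))
      (λ e → e zero , e ∘ suc) (λ { e e′ zero → e ; e e′ (suc x) → e′ x })))
    (*-assoc ⟦ y ≟ᶠ k zero ⟧ _ _)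

-- Precomposition with a bijection permutes the maps only up to pointwise agreement. Hence the
-- detour through a double sum with the indicator of k = h ∘ ι, which also reads h = k ∘ κ and so
-- can be summed out over either variable.
sumF-reindex : ∀ {n n′ m} (ι : Fin n′ → Fin n) (κ : Fin n → Fin n′) → (∀ x → ι (κ x) ≡ x) → (∀ x → κ (ι x) ≡ x) →
               (F : (Fin n′ → Fin m) → ℤ) → Ext F → sumF n (λ h → F (h ∘ ι)) ≡ sumF n′ F
sumF-reindex {n} {n′} ι κ ικ κι F ext = begin
  sumF n (λ h → F (h ∘ ι))                                       ≡⟨ sumF-cong n (λ h → sym (sumF-delta n′ (h ∘ ι) F ext)) ⟩
  sumF n (λ h → sumF n′ (λ k → ⟦ k ≗? (h ∘ ι) ⟧ * F k))          ≡⟨ sumF-comm n n′ _ ⟩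
  sumF n′ (λ k → sumF n (λ h → ⟦ k ≗? (h ∘ ι) ⟧ * F k))          ≡⟨ sumF-cong n′ (λ k → sumF-cong n (λ h → cong (_* F k) (flip k h))) ⟩
  sumF n′ (λ k → sumF n (λ h → ⟦ h ≗? (k ∘ κ) ⟧ * F k))          ≡⟨ sumF-cong n′ (λ k → sumF-delta n (k ∘ κ) (λ _ → F k) (λ _ → refl)) ⟩
  sumF n′ F ∎
  where
  flip : ∀ k h → ⟦ k ≗? (h ∘ ι) ⟧ ≡ ⟦ h ≗? (k ∘ κ) ⟧
  flip k h = ⟦⟧-cong (k ≗? (h ∘ ι)) (h ≗? (k ∘ κ))
    (λ e x → trans (cong h (sym (ικ x))) (sym (e (κ x))))
    (λ e x → sym (trans (e (ι x)) (cong k (κι x))))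

prod-agree-off : ∀ {n} (f g : Fin n → ℤ) x c → (∀ y → y ≢ x → f y ≡ g y) → f x ≡ c * g x → prod f ≡ c * prod g
prod-agree-off {suc n} f g zero c off at = begin
  prod f                        ≡⟨ prod-suc f ⟩
  f zero * prod (f ∘ suc)       ≡⟨ cong₂ _*_ at (prod-cong (λ y → off (suc y) λ ())) ⟩
  c * g zero * prod (g ∘ suc)   ≡⟨ *-assoc c _ _ ⟩
  c * (g zero * prod (g ∘ suc)) ≡⟨ cong (c *_) (prod-suc g) ⟨
  c * prod g ∎
prod-agree-off {suc n} f g (suc x) c off at = begin
  prod f                        ≡⟨ prod-suc f ⟩
  f zero * prod (f ∘ suc)       ≡⟨ cong₂ _*_ (off zero λ ()) (prod-agree-off (f ∘ suc) (g ∘ suc) x c (λ y ne → off (suc y) (ne ∘ sucᶠ-injective)) at) ⟩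
  g zero * (c * prod (g ∘ suc)) ≡⟨ lemma (g zero) c (prod (g ∘ suc)) ⟩
  c * (g zero * prod (g ∘ suc)) ≡⟨ cong (c *_) (prod-suc g) ⟨
  c * prod g ∎
  where
  lemma : ∀ a b c → a * (b * c) ≡ b * (a * c)
  lemma = solve-∀

-- A product is linear in each factor. The multiplier `c` is carried along because functions in the
-- algebra are linear combinations only up to a nonzero integer factor.
prod-linear : ∀ {n} (f g h : Fin n → ℤ) x (c a b : ℤ) → (∀ y → y ≢ x → f y ≡ h y × g y ≡ h y) →
              c * h x ≡ a * f x + b * g x → c * prod h ≡ a * prod f + b * prod g
prod-linear {suc n} f g h zero c a b off at = begin
  c * prod h                      ≡⟨ cong (c *_) (prod-suc h) ⟩
  c * (h zero * prod (h ∘ suc))   ≡⟨ *-assoc c _ _ ⟨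
  c * h zero * prod (h ∘ suc)     ≡⟨ cong (_* prod (h ∘ suc)) at ⟩
  (a * f zero + b * g zero) * prod (h ∘ suc)  ≡⟨ lemma a (f zero) b (g zero) (prod (h ∘ suc)) ⟩
  a * (f zero * prod (h ∘ suc)) + b * (g zero * prod (h ∘ suc))
    ≡⟨ cong₂ (λ u v → a * (f zero * u) + b * (g zero * v)) (prod-cong (λ y → sym (proj₁ (off (suc y) λ ()))))
                                                               (prod-cong (λ y → sym (proj₂ (off (suc y) λ ())))) ⟩
  a * (f zero * prod (f ∘ suc)) + b * (g zero * prod (g ∘ suc)) ≡⟨ cong₂ (λ u v → a * u + b * v) (prod-suc f) (prod-suc g) ⟨
  a * prod f + b * prod g ∎
  where
  lemma : ∀ a f b g p → (a * f + b * g) * p ≡ a * (f * p) + b * (g * p)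
  lemma = solve-∀
prod-linear {suc n} f g h (suc x) c a b off at = begin
  c * prod h                      ≡⟨ cong (c *_) (prod-suc h) ⟩
  c * (h zero * prod (h ∘ suc))   ≡⟨ lemma₁ c (h zero) (prod (h ∘ suc)) ⟩
  h zero * (c * prod (h ∘ suc))
    ≡⟨ cong (h zero *_) (prod-linear (f ∘ suc) (g ∘ suc) (h ∘ suc) x c a b (λ y ne → off (suc y) (ne ∘ sucᶠ-injective)) at) ⟩
  h zero * (a * prod (f ∘ suc) + b * prod (g ∘ suc)) ≡⟨ lemma₂ (h zero) a (prod (f ∘ suc)) b (prod (g ∘ suc)) ⟩
  a * (h zero * prod (f ∘ suc)) + b * (h zero * prod (g ∘ suc))
    ≡⟨ cong₂ (λ u v → a * (u * prod (f ∘ suc)) + b * (v * prod (g ∘ suc))) (proj₁ (off zero λ ())) (proj₂ (off zero λ ())) ⟨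
  a * (f zero * prod (f ∘ suc)) + b * (g zero * prod (g ∘ suc)) ≡⟨ cong₂ (λ u v → a * u + b * v) (prod-suc f) (prod-suc g) ⟨
  a * prod f + b * prod g ∎
  where
  lemma₁ : ∀ a b c → a * (b * c) ≡ b * (a * c)
  lemma₁ = solve-∀
  lemma₂ : ∀ h a f b g → h * (a * f + b * g) ≡ a * (h * f) + b * (h * g)
  lemma₂ = solve-∀

-- Matchings and multiset equality

-- A bijection encoded by its decidable graph on indices instead of a map between Σ-types: it is
-- symmetric in the two sides, `sum-match` can sum over it, and partners can be exchanged by editing
-- the relation.
record Matching {a b} (P : Fin a → Set) (Q : Fin b → Set) (R : Fin a → Fin b → Set) : Set₁ where
  field
    T          : Fin a → Fin b → Set
    T?         : ∀ x y → Dec (T x y)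
    functional : ∀ {x y y′} → T x y → T x y′ → y ≡ y′
    injective  : ∀ {x x′ y} → T x y → T x′ y → x ≡ x′
    totalˡ     : ∀ {x} → P x → ∃ λ y → T x y
    totalʳ     : ∀ {y} → Q y → ∃ λ x → T x y
    sound      : ∀ {x y} → T x y → P x × Q y × R x y

matching-sum : ∀ {a b} {P : Fin a → Set} {Q : Fin b → Set} {R} → Matching P Q R →
               (∀ x → Dec (P x)) → (∀ y → Dec (Q y)) →
               (f : Fin a → ℤ) (g : Fin b → ℤ) → (∀ {x y} → P x → Q y → R x y → f x ≡ g y) →
               (∀ x → ¬ P x → f x ≡ 0ℤ) → (∀ y → ¬ Q y → g y ≡ 0ℤ) → sum f ≡ sum g
matching-sum {P = P} {Q} M P? Q? f g f≡g f0 g0 =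
  sum-match T? functional injective f g (λ t → let p , q , r = sound t in f≡g p q r) totˡ totʳ
  where
  open Matching M
  totˡ : ∀ x → f x ≡ 0ℤ ⊎ ∃ λ y → T x y
  totˡ x with P? x
  ... | yes p = inj₂ (totalˡ p)
  ... | no ¬p = inj₁ (f0 x ¬p)
  totʳ : ∀ y → g y ≡ 0ℤ ⊎ ∃ λ x → T x y
  totʳ y with Q? y
  ... | yes q = inj₂ (totalʳ q)
  ... | no ¬q = inj₁ (g0 y ¬q)

Irrelevant : ∀ {a} → (Fin a → Set) → Set
Irrelevant P = ∀ {x} (p q : P x) → p ≡ q

-- Irrelevance makes the partner of an index independent of the membership proof, so the graph of
-- the bijection lives on indices and inherits decidability from `P`.
mset⇒matching : ∀ {a b} {P : Fin a → Set} {Q : Fin b → Set} {R} → (∀ x → Dec (P x)) → Irrelevant P → Irrelevant Q →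
                MSetEq P Q R → Matching P Q R
mset⇒matching {P = P} {Q} {R} P? P-irr Q-irr (σ , r) = record
  { T = T ; T? = T? ; functional = functional ; injective = injective
  ; totalˡ = λ p → proj₁ (to (_ , p)) , p , refl
  ; totalʳ = λ q → let (x , p) , e = surjective (_ , q) in x , p , cong proj₁ (e refl)
  ; sound = λ { (p , refl) → p , proj₂ (to (_ , p)) , r (_ , p) } }
  where
  open Bijection σ using (to; bijective)
  surjective = proj₂ bijective
  T : _ → _ → Set
  T x y = Σ (P x) λ p → proj₁ (to (x , p)) ≡ y
  T? : ∀ x y → Dec (T x y)
  T? x y with P? x
  ... | no ¬p = no (¬p ∘ proj₁)
  ... | yes p with proj₁ (to (x , p)) ≟ᶠ y
  ...   | yes e = yes (p , e)
  ...   | no ¬e = no λ (p′ , e) → ¬e (trans (cong (λ p → proj₁ (to (x , p))) (P-irr p p′)) e)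
  functional : ∀ {x y y′} → T x y → T x y′ → y ≡ y′
  functional (p , refl) (p′ , refl) = cong (λ p → proj₁ (to (_ , p))) (P-irr p p′)
  pair≡ : ∀ {s t : Σ _ Q} → proj₁ s ≡ proj₁ t → s ≡ t
  pair≡ {y , q} {.y , q′} refl = cong (y ,_) (Q-irr q q′)
  injective : ∀ {x x′ y} → T x y → T x′ y → x ≡ x′
  injective (p , e) (p′ , e′) = cong proj₁ (proj₁ bijective (pair≡ (trans e (sym e′))))

matching⇒mset : ∀ {a b} {P : Fin a → Set} {Q : Fin b → Set} {R} → Irrelevant P → Irrelevant Q → Matching P Q R → MSetEq P Q R
matching⇒mset {P = P} {Q} P-irr Q-irr M = mk⤖ {to = to} (inj , surj) , λ (x , p) → proj₂ (proj₂ (sound (proj₂ (totalˡ p))))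
  where
  open Matching M
  to : Σ _ P → Σ _ Q
  to (x , p) = let y , t = totalˡ p in y , proj₁ (proj₂ (sound t))
  pair≡ : ∀ {n} {A : Fin n → Set} → Irrelevant A → ∀ {s t : Σ _ A} → proj₁ s ≡ proj₁ t → s ≡ t
  pair≡ irr {y , q} {.y , q′} refl = cong (y ,_) (irr q q′)
  inj : ∀ {s t} → to s ≡ to t → s ≡ t
  inj {x , p} {x′ , p′} e = pair≡ P-irr (injective (subst (T x) (cong proj₁ e) (proj₂ (totalˡ p))) (proj₂ (totalˡ p′)))
  surj : ∀ t → ∃ λ s → ∀ {s′} → s′ ≡ s → to s′ ≡ t
  surj (y , q) = let x , t = totalʳ q ; p = proj₁ (sound t) in
    (x , p) , λ { refl → pair≡ Q-irr (functional (proj₂ (totalˡ p)) t) }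

-- Difunctionality: what remains of symmetry and transitivity for a relation between two different
-- sets that expresses equality of colours.
Zigzag : ∀ {a b} → (Fin a → Fin b → Set) → Set
Zigzag R = ∀ {x y x′ y′} → R x y → R x′ y → R x′ y′ → R x y′

-- Exchanging two partners makes any R-related pair matched.
reroot : ∀ {a b} {P : Fin a → Set} {Q : Fin b → Set} {R} → Zigzag R → (M : Matching P Q R) →
         ∀ {v w} → P v → Q w → R v w → Σ (Matching P Q R) λ M′ → Matching.T M′ v w
reroot {P = P} {Q} {R} zz M {v} {w} pv qw rvw = record
  { T = T′
  ; T? = λ x y → ((x ≟ᶠ v) ×-dec (y ≟ᶠ w)) ⊎-dec (¬? (x ≟ᶠ v) ×-dec (¬? (y ≟ᶠ w) ×-dec (T? x y ⊎-dec (T? x w ×-dec T? v y))))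
  ; functional = fun ; injective = inj ; totalˡ = totˡ ; totalʳ = totʳ ; sound = snd } , inj₁ (refl , refl)
  where
  open Matching M
  T′ : _ → _ → Set
  T′ x y = (x ≡ v × y ≡ w) ⊎ (x ≢ v × y ≢ w × (T x y ⊎ (T x w × T v y)))
  fun : ∀ {x y y′} → T′ x y → T′ x y′ → y ≡ y′
  fun (inj₁ (_ , refl)) (inj₁ (_ , refl)) = refl
  fun (inj₁ (e , _)) (inj₂ (n , _)) = ⊥-elim (n e)
  fun (inj₂ (n , _)) (inj₁ (e , _)) = ⊥-elim (n e)
  fun (inj₂ (_ , _ , inj₁ t)) (inj₂ (_ , _ , inj₁ t′)) = functional t t′
  fun (inj₂ (_ , n , inj₁ t)) (inj₂ (_ , _ , inj₂ (t′ , _))) = ⊥-elim (n (functional t t′))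
  fun (inj₂ (_ , _ , inj₂ (t , _))) (inj₂ (_ , n , inj₁ t′)) = ⊥-elim (n (functional t′ t))
  fun (inj₂ (_ , _ , inj₂ (_ , t))) (inj₂ (_ , _ , inj₂ (_ , t′))) = functional t t′
  inj : ∀ {x x′ y} → T′ x y → T′ x′ y → x ≡ x′
  inj (inj₁ (refl , _)) (inj₁ (refl , _)) = refl
  inj (inj₁ (_ , e)) (inj₂ (_ , n , _)) = ⊥-elim (n e)
  inj (inj₂ (_ , n , _)) (inj₁ (_ , e)) = ⊥-elim (n e)
  inj (inj₂ (_ , _ , inj₁ t)) (inj₂ (_ , _ , inj₁ t′)) = injective t t′
  inj (inj₂ (n , _ , inj₁ t)) (inj₂ (_ , _ , inj₂ (_ , t′))) = ⊥-elim (n (injective t t′))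
  inj (inj₂ (_ , _ , inj₂ (_ , t))) (inj₂ (n , _ , inj₁ t′)) = ⊥-elim (n (injective t′ t))
  inj (inj₂ (_ , _ , inj₂ (t , _))) (inj₂ (_ , _ , inj₂ (t′ , _))) = injective t t′
  totˡ : ∀ {x} → P x → ∃ λ y → T′ x y
  totˡ {x} px with x ≟ᶠ v
  ... | yes e = w , inj₁ (e , refl)
  ... | no n with totalˡ px
  ...   | y , t with y ≟ᶠ w
  ...     | no m = y , inj₂ (n , m , inj₁ t)
  ...     | yes refl with totalˡ pv
  ...       | y′ , t′ = y′ , inj₂ (n , (λ { refl → n (injective t t′) }) , inj₂ (t , t′))
  totʳ : ∀ {y} → Q y → ∃ λ x → T′ x y
  totʳ {y} qy with y ≟ᶠ w
  ... | yes e = v , inj₁ (refl , e)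
  ... | no n with totalʳ qy
  ...   | x , t with x ≟ᶠ v
  ...     | no m = x , inj₂ (m , n , inj₁ t)
  ...     | yes refl with totalʳ qw
  ...       | x′ , t′ = x′ , inj₂ ((λ { refl → n (functional t t′) }) , n , inj₂ (t′ , t))
  snd : ∀ {x y} → T′ x y → P x × Q y × R x y
  snd (inj₁ (refl , refl)) = pv , qw , rvw
  snd (inj₂ (_ , _ , inj₁ t)) = sound t
  snd (inj₂ (_ , _ , inj₂ (t , t′))) = let px , _ , r = sound t ; _ , qy , r′ = sound t′ in px , qy , zz r rvw r′

𝟙 : ∀ {P : Set} → Dec P → ℕ
𝟙 (yes _) = 1
𝟙 (no _)  = 0

𝟙-cong : ∀ {P Q : Set} (d : Dec P) (d′ : Dec Q) → (P → Q) → (Q → P) → 𝟙 d ≡ 𝟙 d′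
𝟙-cong (yes _) (yes _) f g = refl
𝟙-cong (yes p) (no ¬q) f g = ⊥-elim (¬q (f p))
𝟙-cong (no ¬p) (yes q) f g = ⊥-elim (¬p (g q))
𝟙-cong (no _)  (no _)  f g = refl

count : ∀ {n} {D : Fin n → Set} → (∀ x → Dec (D x)) → ℕ
count {zero}  D? = 0
count {suc n} D? = 𝟙 (D? zero) ℕ.+ count (D? ∘ suc)

-- The position among the elements of `D`, counted from 0, so that the members of `D` occupy exactly
-- the ranks below `count`.
rank : ∀ {n} {D : Fin n → Set} → (∀ x → Dec (D x)) → Fin n → ℕ
rank D? zero    = 0
rank D? (suc x) = 𝟙 (D? zero) ℕ.+ rank (D? ∘ suc) x

count-sum : ∀ {n} {D : Fin n → Set} (D? : ∀ x → Dec (D x)) → sum (λ x → ⟦ D? x ⟧) ≡ + count D?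
count-sum {zero}  D? = sum-0 _
count-sum {suc n} D? = trans (sum-suc _) (trans (cong (_+_ ⟦ D? zero ⟧) (count-sum (D? ∘ suc)))
  (trans (cong (_+ (+ count (D? ∘ suc))) (lemma (D? zero))) (sym (pos-+ (𝟙 (D? zero)) (count (D? ∘ suc))))))
  where
  lemma : ∀ {P} (d : Dec P) → ⟦ d ⟧ ≡ + 𝟙 d
  lemma (yes _) = refl
  lemma (no _)  = refl

rank-cong : ∀ {n} {D D′ : Fin n → Set} (D? : ∀ x → Dec (D x)) (D′? : ∀ x → Dec (D′ x)) →
            (∀ {x} → D x → D′ x) → (∀ {x} → D′ x → D x) → ∀ x → rank D? x ≡ rank D′? x
rank-cong D? D′? f g zero    = refl
rank-cong D? D′? f g (suc x) = cong₂ ℕ._+_ (𝟙-cong (D? zero) (D′? zero) f g) (rank-cong (D? ∘ suc) (D′? ∘ suc) f g x)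

rank<count : ∀ {n} {D : Fin n → Set} (D? : ∀ x → Dec (D x)) x → D x → rank D? x ℕ.< count D?
rank<count D? zero dx with D? zero
... | yes _ = ℕ.s≤s ℕ.z≤n
... | no ¬d = ⊥-elim (¬d dx)
rank<count D? (suc x) dx = ℕ.+-monoʳ-< (𝟙 (D? zero)) (rank<count (D? ∘ suc) x dx)

rank-injective : ∀ {n} {D : Fin n → Set} (D? : ∀ x → Dec (D x)) {x y} → D x → D y → rank D? x ≡ rank D? y → x ≡ y
rank-injective D? {zero}  {zero}  dx dy e = refl
rank-injective D? {zero}  {suc y} dx dy e with D? zero
rank-injective D? {zero}  {suc y} dx dy () | yes _
... | no ¬d = ⊥-elim (¬d dx)
rank-injective D? {suc x} {zero}  dx dy e with D? zero
rank-injective D? {suc x} {zero}  dx dy () | yes _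
... | no ¬d = ⊥-elim (¬d dy)
rank-injective D? {suc x} {suc y} dx dy e =
  cong suc (rank-injective (D? ∘ suc) dx dy (ℕ.+-cancelˡ-≡ (𝟙 (D? zero)) _ _ e))

select : ∀ {n} {D : Fin n → Set} (D? : ∀ x → Dec (D x)) {j} → j ℕ.< count D? → ∃ λ x → D x × rank D? x ≡ j
select {suc n} D? {j} j< with D? zero in eq
select {suc n} D? {zero}  j<          | yes d = zero , d , refl
select {suc n} D? {suc j} (ℕ.s≤s j<) | yes d =
  let x , dx , e = select (D? ∘ suc) j< in suc x , dx , cong₂ ℕ._+_ (cong 𝟙 eq) e
... | no ¬d = let x , dx , e = select (D? ∘ suc) j< in suc x , dx , trans (cong (λ d → 𝟙 d ℕ.+ rank (D? ∘ suc) x) eq) e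

-- Elements are paired with the element of the same class and the same rank in it.
counts⇒matching : ∀ {Z : Set} {_~_ : Z → Z → Set} (_~?_ : ∀ z z′ → Dec (z ~ z′)) →
  (∀ {z z′} → z ~ z′ → z′ ~ z) → (∀ {z z′ z″} → z ~ z′ → z′ ~ z″ → z ~ z″) →
  ∀ {a b} {P : Fin a → Set} {Q : Fin b → Set} (P? : ∀ x → Dec (P x)) (Q? : ∀ y → Dec (Q y)) (p : Fin a → Z) (q : Fin b → Z) →
  (∀ z → sum (λ x → ⟦ P? x ×-dec (p x ~? z) ⟧) ≡ sum (λ y → ⟦ Q? y ×-dec (q y ~? z) ⟧)) →
  (∀ {z} → z ~ z) → Matching P Q (λ x y → p x ~ q y)
counts⇒matching {_~_ = _~_} _~?_ ~sym ~trans {P = P} {Q} P? Q? p q counts ~refl = record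
  { T = T
  ; T? = λ x y → P? x ×-dec (Q? y ×-dec ((p x ~? q y) ×-dec (rank (DP? (p x)) x ℕ.≟ rank (DQ? (p x)) y)))
  ; functional = λ (_ , qy , s , e) (_ , qy′ , s′ , e′) → rank-injective (DQ? _) (qy , ~sym s) (qy′ , ~sym s′) (trans (sym e) e′)
  ; injective = λ {x} {x′} {y} (px , _ , s , e) (px′ , _ , s′ , e′) → rank-injective (DP? (p x)) (px , ~refl) (px′ , ~trans s′ (~sym s))
      (trans e (trans (DQ-cong (~trans s (~sym s′)) y) (trans (sym e′) (DP-cong (~trans s′ (~sym s)) x′))))
  ; totalˡ = λ {x} px → let y , (qy , s) , e = select (DQ? (p x)) (subst (rank (DP? (p x)) x ℕ.<_) (count≡ (p x)) (rank<count (DP? (p x)) x (px , ~refl))) in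
      y , px , qy , ~sym s , sym e
  ; totalʳ = λ {y} qy → let x , (px , s) , e = select (DP? (q y)) (subst (rank (DQ? (q y)) y ℕ.<_)
                                                            (sym (count≡ (q y))) (rank<count (DQ? (q y)) y (qy , ~refl))) in
      x , px , qy , s , trans (DP-cong s x) (trans e (DQ-cong (~sym s) y))
  ; sound = λ (px , qy , s , _) → px , qy , s }
  where
  DP? : ∀ z x → Dec (P x × p x ~ z)
  DP? z x = P? x ×-dec (p x ~? z)
  DQ? : ∀ z y → Dec (Q y × q y ~ z)
  DQ? z y = Q? y ×-dec (q y ~? z)
  T : _ → _ → Set
  T x y = P x × Q y × (p x ~ q y) × rank (DP? (p x)) x ≡ rank (DQ? (p x)) y
  count≡ : ∀ z → count (DP? z) ≡ count (DQ? z)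
  count≡ z = +-injective (trans (sym (count-sum (DP? z))) (trans (counts z) (count-sum (DQ? z))))
  DP-cong : ∀ {z z′} → z ~ z′ → ∀ x → rank (DP? z) x ≡ rank (DP? z′) x
  DP-cong s = rank-cong (DP? _) (DP? _) (λ (a , t) → a , ~trans t s) (λ (a , t) → a , ~trans t (~sym s))
  DQ-cong : ∀ {z z′} → z ~ z′ → ∀ x → rank (DQ? z) x ≡ rank (DQ? z′) x
  DQ-cong s = rank-cong (DQ? _) (DQ? _) (λ (a , t) → a , ~trans t s) (λ (a , t) → a , ~trans t (~sym s))

-- Weighted homomorphism counts

_≟ˢ_ : ∀ {n} (p q : Subset n) → Dec (p ≡ q)
_≟ˢ_ = ≡-dec _≟ᵇ_

-- Φ K e p fs = Σ_s Π_j fs j (s j) over all s : Fin k → V(K) with p ∪ {s j : j} = f_K(e).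
Φ : (K : Hypergraph) → Fin (nE K) → Subset (nV K) → ∀ {k} → (Fin k → Fin (nV K) → ℤ) → ℤ
Φ K e p {zero}  fs = ⟦ p ≟ˢ inc K e ⟧
Φ K e p {suc k} fs = sum (λ u → fs zero u * Φ K e (p ∪ ⁅ u ⁆) (fs ∘ suc))

-- The sum may run over all edges, since by `Φ-outside` an edge that misses v contributes 0.
ψ : (K : Hypergraph) → ∀ {k} → (Fin k → Fin (nV K) → ℤ) → Fin (nV K) → ℤ
ψ K fs v = sum (λ e → Φ K e ⁅ v ⁆ fs)

∈-cases : ∀ {n} {x u : Fin n} (p : Subset n) → x ∈ p ∪ ⁅ u ⁆ → x ∈ p ⊎ x ≡ u
∈-cases {u = u} p x∈ = Sum.map₂ (x∈⁅y⁆⇒x≡y u) (x∈p∪q⁻ p ⁅ u ⁆ x∈)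

∈-left : ∀ {n} {x u : Fin n} {p : Subset n} → x ∈ p → x ∈ p ∪ ⁅ u ⁆
∈-left {u = u} = p⊆p∪q ⁅ u ⁆

∈-here : ∀ {n} {u : Fin n} (p : Subset n) → u ∈ p ∪ ⁅ u ⁆
∈-here {u = u} p = q⊆p∪q p ⁅ u ⁆ (x∈⁅x⁆ u)

Φ-outside : ∀ K e p {k} (fs : Fin k → Fin (nV K) → ℤ) {x} → x ∈ p → x ∉ inc K e → Φ K e p fs ≡ 0ℤ
Φ-outside K e p {zero}  fs x∈p x∉e = ⟦⟧-false (p ≟ˢ inc K e) λ { refl → x∉e x∈p }
Φ-outside K e p {suc k} fs x∈p x∉e = sum-zero _ λ u →
  trans (cong (fs zero u *_) (Φ-outside K e (p ∪ ⁅ u ⁆) (fs ∘ suc) (∈-left x∈p) x∉e)) (*-zeroʳ (fs zero u))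

module _ (K L : Hypergraph) {e : Fin (nE K)} {e′ : Fin (nE L)} {R : Fin (nV K) → Fin (nV L) → Set}
         (M : Matching (_∈ inc K e) (_∈ inc L e′) R) where
  open Matching M

  -- The matching carries placements in e to placements in e′ one vertex at a time, and the covered
  -- sets keep corresponding to each other. A placement that leaves its edge contributes 0, so
  -- unmatched vertices do not matter.
  Φ-matching : ∀ p p′ {k} (fs : Fin k → Fin (nV K) → ℤ) (fs′ : Fin k → Fin (nV L) → ℤ) →
               p ⊆ inc K e → p′ ⊆ inc L e′ → (∀ {x y} → T x y → (x ∈ p → y ∈ p′) × (y ∈ p′ → x ∈ p)) →
               (∀ j {x y} → R x y → fs j x ≡ fs′ j y) → Φ K e p fs ≡ Φ L e′ p′ fs′
  Φ-matching p p′ {zero} fs fs′ p⊆ p′⊆ p~p′ fs≡ = ⟦⟧-cong (p ≟ˢ inc K e) (p′ ≟ˢ inc L e′)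
    (λ { refl → ⊆-antisym p′⊆ λ y∈ → let x , t = totalʳ y∈ in proj₁ (p~p′ t) (proj₁ (sound t)) })
    (λ { refl → ⊆-antisym p⊆ λ x∈ → let y , t = totalˡ x∈ in proj₂ (p~p′ t) (proj₁ (proj₂ (sound t))) })
  Φ-matching p p′ {suc k} fs fs′ p⊆ p′⊆ p~p′ fs≡ =
    sum-match T? functional injective _ _
      (λ {u} {u′} t → let u∈ , u′∈ , r = sound t in
        cong₂ _*_ (fs≡ zero r) (Φ-matching (p ∪ ⁅ u ⁆) (p′ ∪ ⁅ u′ ⁆) (fs ∘ suc) (fs′ ∘ suc)
          (λ x∈ → ⊆-insert p u p⊆ u∈ (∈-cases p x∈)) (λ x∈ → ⊆-insert p′ u′ p′⊆ u′∈ (∈-cases p′ x∈))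
          (λ t′ → (λ x∈ → fwd t t′ (∈-cases p x∈)) , (λ y∈ → bwd t t′ (∈-cases p′ y∈)))
          (fs≡ ∘ suc)))
      (λ u → dichotomy K e p fs u totalˡ) (λ u → dichotomy L e′ p′ fs′ u totalʳ)
    where
    ⊆-insert : ∀ {n} {q : Subset n} p u {x} → p ⊆ q → u ∈ q → x ∈ p ⊎ x ≡ u → x ∈ q
    ⊆-insert p u p⊆ u∈ (inj₁ x∈) = p⊆ x∈
    ⊆-insert p u p⊆ u∈ (inj₂ refl) = u∈
    fwd : ∀ {u u′ x y} → T u u′ → T x y → x ∈ p ⊎ x ≡ u → y ∈ p′ ∪ ⁅ u′ ⁆
    fwd t t′ (inj₁ x∈)   = ∈-left (proj₁ (p~p′ t′) x∈)
    fwd t t′ (inj₂ refl) with refl ← functional t t′ = ∈-here p′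
    bwd : ∀ {u u′ x y} → T u u′ → T x y → y ∈ p′ ⊎ y ≡ u′ → x ∈ p ∪ ⁅ u ⁆
    bwd t t′ (inj₁ y∈)   = ∈-left (proj₂ (p~p′ t′) y∈)
    bwd t t′ (inj₂ refl) with refl ← injective t t′ = ∈-here p
    dichotomy : ∀ K e p {k} (fs : Fin (suc k) → Fin (nV K) → ℤ) u {A : Set} → (u ∈ inc K e → A) →
                fs zero u * Φ K e (p ∪ ⁅ u ⁆) (fs ∘ suc) ≡ 0ℤ ⊎ A
    dichotomy K e p fs u tot with u ∈? inc K e
    ... | yes u∈ = inj₂ (tot u∈)
    ... | no  u∉ = inj₁ (trans (cong (fs zero u *_) (Φ-outside K e (p ∪ ⁅ u ⁆) (fs ∘ suc) (∈-here p) u∉)) (*-zeroʳ (fs zero u)))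

-- The given matching may pair v and w with other vertices; `reroot` repairs this, after which the
-- initial covered sets {v} and {w} correspond.
Φ-rooted : ∀ K L {e e′} {R : Fin (nV K) → Fin (nV L) → Set} → Zigzag R → Matching (_∈ inc K e) (_∈ inc L e′) R →
           ∀ {v w} → v ∈ inc K e → w ∈ inc L e′ → R v w →
           ∀ {k} (fs : Fin k → Fin (nV K) → ℤ) (fs′ : Fin k → Fin (nV L) → ℤ) →
           (∀ j {x y} → R x y → fs j x ≡ fs′ j y) → Φ K e ⁅ v ⁆ fs ≡ Φ L e′ ⁅ w ⁆ fs′
Φ-rooted K L zz M {v} {w} v∈ w∈ r fs fs′ fs≡ =
  let M′ , t = reroot zz M v∈ w∈ r in
  Φ-matching K L M′ ⁅ v ⁆ ⁅ w ⁆ fs fs′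
    (λ x∈ → subst (_∈ _) (sym (x∈⁅y⁆⇒x≡y v x∈)) v∈) (λ y∈ → subst (_∈ _) (sym (x∈⁅y⁆⇒x≡y w y∈)) w∈)
    (λ {x} {y} t′ →
      (λ x∈ → subst (_∈ ⁅ w ⁆) (Matching.functional M′ t (subst (λ x → Matching.T M′ x y) (x∈⁅y⁆⇒x≡y v x∈) t′)) (x∈⁅x⁆ w)) ,
      (λ y∈ → subst (_∈ ⁅ v ⁆) (Matching.injective M′ t (subst (λ y → Matching.T M′ x y) (x∈⁅y⁆⇒x≡y w y∈) t′)) (x∈⁅x⁆ v)))
    fs≡

-- Attaching an edge and summing it out

∈-image⁺ : ∀ {a b} (h : Fin a → Fin b) {p : Subset a} {x} → x ∈ p → h x ∈ image h p
∈-image⁺ h {p} {x} x∈p = lookup⇒[]= (h x) _ (trans (lookup∘tabulate _ (h x))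
  (dec-true (any? (λ x′ → (x′ ∈? p) ×-dec (h x′ ≟ᶠ h x))) (x , x∈p , refl)))

∈-image⁻ : ∀ {a b} (h : Fin a → Fin b) {p : Subset a} {y} → y ∈ image h p → ∃ λ x → x ∈ p × h x ≡ y
∈-image⁻ h {p} {y} y∈ = witness (any? (λ x → (x ∈? p) ×-dec (h x ≟ᶠ y))) (trans (sym (lookup∘tabulate _ y)) ([]=⇒lookup y∈))
  where
  witness : ∀ {A : Set} (d : Dec A) → does d ≡ true → A
  witness (yes a) _ = a

image-cong : ∀ {a b} {h k : Fin a → Fin b} p → (∀ x → h x ≡ k x) → image h p ≡ image k p
image-cong {h = h} {k} p eq = ⊆-antisym
  (λ y∈ → let x , x∈ , e = ∈-image⁻ h y∈ in subst (_∈ image k p) (trans (sym (eq x)) e) (∈-image⁺ k x∈))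
  (λ y∈ → let x , x∈ , e = ∈-image⁻ k y∈ in subst (_∈ image h p) (trans (eq x) e) (∈-image⁺ h x∈))

image-∘ : ∀ {a b c} (h : Fin b → Fin c) (k : Fin a → Fin b) p → image h (image k p) ≡ image (h ∘ k) p
image-∘ h k p = ⊆-antisym
  (λ z∈ → let y , y∈ , e = ∈-image⁻ h z∈ ; x , x∈ , e′ = ∈-image⁻ k y∈ in
    subst (_∈ image (h ∘ k) p) (trans (cong h e′) e) (∈-image⁺ (h ∘ k) x∈))
  (λ z∈ → let x , x∈ , e = ∈-image⁻ (h ∘ k) z∈ in
    subst (_∈ image h (image k p)) e (∈-image⁺ h (∈-image⁺ k x∈)))

infixr 5 _⧺_
-- Concatenation by recursion with `VF.∷` rather than through `splitAt`, so that it unfolds in step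
-- with `sumF`.
_⧺_ : ∀ {A : Set} {k n} → (Fin k → A) → (Fin n → A) → Fin (k ℕ.+ n) → A
_⧺_ {k = zero}  s g = g
_⧺_ {k = suc k} s g = s zero VF.∷ ((s ∘ suc) ⧺ g)

⧺-↑ˡ : ∀ {A : Set} {k n} (s : Fin k → A) (g : Fin n → A) j → (s ⧺ g) (j ↑ˡ n) ≡ s j
⧺-↑ˡ s g zero    = refl
⧺-↑ˡ s g (suc j) = ⧺-↑ˡ (s ∘ suc) g j

⧺-↑ʳ : ∀ {A : Set} k {n} (s : Fin k → A) (g : Fin n → A) x → (s ⧺ g) (k ↑ʳ x) ≡ g x
⧺-↑ʳ zero    s g x = refl
⧺-↑ʳ (suc k) s g x = ⧺-↑ʳ k (s ∘ suc) g x

data Split (k : ℕ) {n : ℕ} : Fin (k ℕ.+ n) → Set where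
  new : ∀ j → Split k (j ↑ˡ n)
  old : ∀ x → Split k (k ↑ʳ x)

split : ∀ k {n} (i : Fin (k ℕ.+ n)) → Split k i
split k {n} i = subst (Split k) (join-splitAt k n i) (view (splitAt k i))
  where
  view : ∀ s → Split k (join k n s)
  view (inj₁ j) = new j
  view (inj₂ x) = old x

pad : Bool → ∀ k {n} → Subset n → Subset (k ℕ.+ n)
pad b zero    p = p
pad b (suc k) p = b Vec.∷ pad b k p

pad-old⁺ : ∀ {b} k {n} {p : Subset n} {x} → x ∈ p → k ↑ʳ x ∈ pad b k p
pad-old⁺ zero    x∈ = x∈
pad-old⁺ (suc k) x∈ = there (pad-old⁺ k x∈)

pad-old⁻ : ∀ {b} k {n} {p : Subset n} {x} → k ↑ʳ x ∈ pad b k p → x ∈ p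
pad-old⁻ zero    x∈         = x∈
pad-old⁻ (suc k) (there x∈) = pad-old⁻ k x∈

pad-new⁺ : ∀ {k n} {p : Subset n} j → j ↑ˡ n ∈ pad inside k p
pad-new⁺ zero    = here
pad-new⁺ (suc j) = there (pad-new⁺ j)

pad-new⁻ : ∀ {k n} {p : Subset n} (j : Fin k) → j ↑ˡ n ∉ pad outside k p
pad-new⁻ (suc j) (there x∈) = pad-new⁻ j x∈

-- New vertices precede the old ones and the new edge is edge 0, so a pair of maps out of the result
-- splits as `s ⧺ g` on vertices and `y VF.∷ hE` on edges. With k = 0 the new edge is {x}.
attach : (B : Hypergraph) → Fin (nV B) → ℕ → Hypergraph
attach B x k = record { nV = k ℕ.+ nV B ; nE = suc (nE B) ; inc = inc′ ; inc-nonempty = nonempty }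
  where
  inc′ : Fin (suc (nE B)) → Subset (k ℕ.+ nV B)
  inc′ zero    = pad inside k ⁅ x ⁆
  inc′ (suc e) = pad outside k (inc B e)
  nonempty : ∀ e → Nonempty (inc′ e)
  nonempty zero    = k ↑ʳ x , pad-old⁺ k (x∈⁅x⁆ x)
  nonempty (suc e) = let v , v∈ = inc-nonempty B e in k ↑ʳ v , pad-old⁺ k v∈

image-pad-outside : ∀ {k n m} (s : Fin k → Fin m) (g : Fin n → Fin m) p → image (s ⧺ g) (pad outside k p) ≡ image g p
image-pad-outside {k} {n} s g p = ⊆-antisym
  (λ y∈ → let i , i∈ , e = ∈-image⁻ (s ⧺ g) y∈ in fwd i (split k i) i∈ e)
  (λ y∈ → let x , x∈ , e = ∈-image⁻ g y∈ in
    subst (_∈ image (s ⧺ g) (pad outside k p)) (trans (⧺-↑ʳ k s g x) e) (∈-image⁺ (s ⧺ g) (pad-old⁺ k x∈)))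
  where
  fwd : ∀ i → Split k i → i ∈ pad outside k p → ∀ {y} → (s ⧺ g) i ≡ y → y ∈ image g p
  fwd _ (new j) i∈ e = ⊥-elim (pad-new⁻ j i∈)
  fwd _ (old x) i∈ e = subst (_∈ image g p) (trans (sym (⧺-↑ʳ k s g x)) e) (∈-image⁺ g (pad-old⁻ k i∈))

-- Accumulates the covered set in the same order as `Φ`, so that the closed form `Φ-sumF` follows by
-- structural induction.
hit : ∀ {k n} → Subset n → (Fin k → Fin n) → Subset n
hit {zero}  p s = p
hit {suc k} p s = hit (p ∪ ⁅ s zero ⁆) (s ∘ suc)

∈-hit⁺ : ∀ {k n} {p : Subset n} (s : Fin k → Fin n) {y} → y ∈ p ⊎ (∃ λ j → s j ≡ y) → y ∈ hit p s
∈-hit⁺ {zero}  s (inj₁ y∈) = y∈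
∈-hit⁺ {suc k} s (inj₁ y∈) = ∈-hit⁺ (s ∘ suc) (inj₁ (∈-left y∈))
∈-hit⁺ {suc k} {p = p} s (inj₂ (zero , refl)) = ∈-hit⁺ (s ∘ suc) (inj₁ (∈-here p))
∈-hit⁺ {suc k} s (inj₂ (suc j , e)) = ∈-hit⁺ (s ∘ suc) (inj₂ (j , e))

∈-hit⁻ : ∀ {k n} (p : Subset n) (s : Fin k → Fin n) {y} → y ∈ hit p s → y ∈ p ⊎ (∃ λ j → s j ≡ y)
∈-hit⁻ {zero}  p s y∈ = inj₁ y∈
∈-hit⁻ {suc k} p s y∈ with ∈-hit⁻ (p ∪ ⁅ s zero ⁆) (s ∘ suc) y∈
... | inj₂ (j , e) = inj₂ (suc j , e)
... | inj₁ y∈′ with ∈-cases p y∈′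
...   | inj₁ y∈p = inj₁ y∈p
...   | inj₂ e   = inj₂ (zero , sym e)

image-pad-inside : ∀ {k n m} (s : Fin k → Fin m) (g : Fin n → Fin m) x →
                   image (s ⧺ g) (pad inside k ⁅ x ⁆) ≡ hit ⁅ g x ⁆ s
image-pad-inside {k} {n} s g x = ⊆-antisym
  (λ y∈ → let i , i∈ , e = ∈-image⁻ (s ⧺ g) y∈ in fwd i (split k i) i∈ e)
  (λ y∈ → bwd (∈-hit⁻ ⁅ g x ⁆ s y∈))
  where
  fwd : ∀ i → Split k i → i ∈ pad inside k ⁅ x ⁆ → ∀ {y} → (s ⧺ g) i ≡ y → y ∈ hit ⁅ g x ⁆ s
  fwd _ (new j) i∈ e = ∈-hit⁺ s (inj₂ (j , trans (sym (⧺-↑ˡ s g j)) e))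
  fwd _ (old z) i∈ {y} e = ∈-hit⁺ s (inj₁ (subst (_∈ ⁅ g x ⁆)
    (trans (cong g (sym (x∈⁅y⁆⇒x≡y x (pad-old⁻ k i∈)))) (trans (sym (⧺-↑ʳ k s g z)) e)) (x∈⁅x⁆ (g x))))
  bwd : ∀ {y} → y ∈ ⁅ g x ⁆ ⊎ (∃ λ j → s j ≡ y) → y ∈ image (s ⧺ g) (pad inside k ⁅ x ⁆)
  bwd (inj₁ y∈) = subst (_∈ image (s ⧺ g) _) (trans (⧺-↑ʳ k s g x) (sym (x∈⁅y⁆⇒x≡y (g x) y∈)))
    (∈-image⁺ (s ⧺ g) (pad-old⁺ k (x∈⁅x⁆ x)))
  bwd (inj₂ (j , e)) = subst (_∈ image (s ⧺ g) _) (trans (⧺-↑ˡ s g j) e) (∈-image⁺ (s ⧺ g) (pad-new⁺ j))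

HomW : (B K : Hypergraph) → (Fin (nV B) → Fin (nV K) → ℤ) → ℤ
HomW B K φ = sumF (nV B) (λ hV → sumF (nE B) (λ hE → ⟦ isHom? B K hV hE ⟧ * prod (λ x → φ x (hV x))))

HomW-cong : ∀ B K {φ φ′ : Fin (nV B) → Fin (nV K) → ℤ} → (∀ x v → φ x v ≡ φ′ x v) → HomW B K φ ≡ HomW B K φ′
HomW-cong B K eq = sumF-cong (nV B) λ hV → sumF-cong (nE B) λ hE → cong (⟦ isHom? B K hV hE ⟧ *_) (prod-cong λ x → eq x (hV x))

sumF-⧺ : ∀ k n {m} (F : (Fin (k ℕ.+ n) → Fin m) → ℤ) → sumF (k ℕ.+ n) F ≡ sumF k (λ s → sumF n (λ g → F (s ⧺ g)))
sumF-⧺ zero    n F = refl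
sumF-⧺ (suc k) n F = sum-cong (λ y → sumF-⧺ k n (λ h → F (y VF.∷ h)))

prod-⧺ : ∀ {k n m} (fs : Fin k → Fin m → ℤ) (φ : Fin n → Fin m → ℤ) (s : Fin k → Fin m) (g : Fin n → Fin m) →
         prod (λ i → (fs ⧺ φ) i ((s ⧺ g) i)) ≡ prod (λ j → fs j (s j)) * prod (λ x → φ x (g x))
prod-⧺ {zero}  fs φ s g = sym (trans (cong (_* prod (λ x → φ x (g x))) (prod-0 _)) (*-identityˡ _))
prod-⧺ {suc k} fs φ s g = begin
  prod (λ i → (fs ⧺ φ) i ((s ⧺ g) i))
    ≡⟨ prod-suc _ ⟩
  fs zero (s zero) * prod (λ i → ((fs ∘ suc) ⧺ φ) i (((s ∘ suc) ⧺ g) i))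
    ≡⟨ cong (fs zero (s zero) *_) (prod-⧺ (fs ∘ suc) φ (s ∘ suc) g) ⟩
  fs zero (s zero) * (prod (λ j → fs (suc j) (s (suc j))) * prod (λ x → φ x (g x)))
    ≡⟨ *-assoc (fs zero (s zero)) _ _ ⟨
  fs zero (s zero) * prod (λ j → fs (suc j) (s (suc j))) * prod (λ x → φ x (g x))
    ≡⟨ cong (_* prod (λ x → φ x (g x))) (prod-suc _) ⟨
  prod (λ j → fs j (s j)) * prod (λ x → φ x (g x)) ∎

Φ-sumF : ∀ K e p {k} (fs : Fin k → Fin (nV K) → ℤ) →
         Φ K e p fs ≡ sumF k (λ s → ⟦ hit p s ≟ˢ inc K e ⟧ * prod (λ j → fs j (s j)))
Φ-sumF K e p {zero}  fs = sym (trans (cong (⟦ p ≟ˢ inc K e ⟧ *_) (prod-0 _)) (*-identityʳ _))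
Φ-sumF K e p {suc k} fs = sum-cong λ u → begin
  fs zero u * Φ K e (p ∪ ⁅ u ⁆) (fs ∘ suc)
    ≡⟨ cong (fs zero u *_) (Φ-sumF K e (p ∪ ⁅ u ⁆) (fs ∘ suc)) ⟩
  fs zero u * sumF k (λ s → ⟦ hit (p ∪ ⁅ u ⁆) s ≟ˢ inc K e ⟧ * prod (λ j → fs (suc j) (s j)))
    ≡⟨ sumF-*ˡ k (fs zero u) (λ s → ⟦ hit (p ∪ ⁅ u ⁆) s ≟ˢ inc K e ⟧ * prod (λ j → fs (suc j) (s j))) ⟨
  sumF k (λ s → fs zero u * (⟦ hit (p ∪ ⁅ u ⁆) s ≟ˢ inc K e ⟧ * prod (λ j → fs (suc j) (s j))))
    ≡⟨ sumF-cong k (λ s → trans (lemma (fs zero u) ⟦ hit (p ∪ ⁅ u ⁆) s ≟ˢ inc K e ⟧ (prod (λ j → fs (suc j) (s j))))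
         (cong (⟦ hit (p ∪ ⁅ u ⁆) s ≟ˢ inc K e ⟧ *_) (sym (prod-suc _)))) ⟩
  sumF k (λ s → ⟦ hit (p ∪ ⁅ u ⁆) s ≟ˢ inc K e ⟧ * prod (λ j → fs j ((u VF.∷ s) j))) ∎
  where
  lemma : ∀ a b c → a * (b * c) ≡ b * (a * c)
  lemma = solve-∀

-- A homomorphism from the enlarged hypergraph is one from `B` together with an edge of K and a
-- placement of the new vertices that covers it with the image of x. The weights `φ` and `φ′` are
-- tied by equations because one direction of the theorem computes `φ` from `φ′` and the other is
-- given `φ` and supplies `φ′`.
HomW-attach : ∀ B K x {k} (fs : Fin k → Fin (nV K) → ℤ) (φ φ′ : Fin (nV B) → Fin (nV K) → ℤ) →
              (∀ y → y ≢ x → ∀ v → φ y v ≡ φ′ y v) → (∀ v → φ x v ≡ ψ K fs v * φ′ x v) →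
              HomW (attach B x k) K (fs ⧺ φ′) ≡ HomW B K φ
HomW-attach B K x {k} fs φ φ′ off at = begin
  HomW (attach B x k) K (fs ⧺ φ′)
    ≡⟨ sumF-⧺ k n _ ⟩
  sumF k (λ s → sumF n (λ g → sum (λ y → sumF m (λ hE → I′ (s ⧺ g) (y VF.∷ hE) * prod (λ i → (fs ⧺ φ′) i ((s ⧺ g) i))))))
    ≡⟨ sumF-cong k (λ s → sumF-cong n (λ g → sum-cong (λ y → sumF-cong m (λ hE → cong₂ _*_ (isHom-split s g y hE) (prod-⧺ fs φ′ s g))))) ⟩
  sumF k (λ s → sumF n (λ g → sum (λ y → sumF m (λ hE → (H s g y * I g hE) * (P s * Q g)))))
    ≡⟨ sumF-cong k (λ s → sumF-cong n (λ g → trans (sum-cong (λ y →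
         trans (sumF-cong m (λ hE → shuffle (H s g y) (I g hE) (P s) (Q g)))
               (sumF-*ˡ m (H s g y * P s) (λ hE → I g hE * Q g))))
         (sum-*ʳ (λ y → H s g y * P s) (W g)))) ⟩
  sumF k (λ s → sumF n (λ g → sum (λ y → H s g y * P s) * W g))
    -- With the map g on `B` outermost, the sums over the placement s and over the image y of the
    -- new edge form a factor that depends on g x alone.
    ≡⟨ sumF-comm k n _ ⟩
  sumF n (λ g → sumF k (λ s → sum (λ y → H s g y * P s) * W g))
    ≡⟨ sumF-cong n (λ g → trans (sumF-cong k (λ s → *-comm (sum (λ y → H s g y * P s)) (W g)))
                                (sumF-*ˡ k (W g) (λ s → sum (λ y → H s g y * P s)))) ⟩
  sumF n (λ g → W g * sumF k (λ s → sum (λ y → H s g y * P s)))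
    ≡⟨ sumF-cong n (λ g → cong (W g *_) (trans (sumF-sum k _) (sum-cong (λ y → sym (Φ-sumF K y ⁅ g x ⁆ fs))))) ⟩
  sumF n (λ g → W g * ψ K fs (g x))
    ≡⟨ sumF-cong n (λ g → trans (*-comm (W g) (ψ K fs (g x))) (sym (sumF-*ˡ m (ψ K fs (g x)) (λ hE → I g hE * Q g)))) ⟩
  sumF n (λ g → sumF m (λ hE → ψ K fs (g x) * (I g hE * Q g)))
    ≡⟨ sumF-cong n (λ g → sumF-cong m (λ hE → trans (exchange (ψ K fs (g x)) (I g hE) (Q g))
         (cong (I g hE *_) (sym (prod-agree-off _ _ x (ψ K fs (g x)) (λ y y≢x → off y y≢x (g y)) (at (g x))))))) ⟩
  HomW B K φ ∎
  where
  n = nV B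
  m = nE B
  I′ = λ h h′ → ⟦ isHom? (attach B x k) K h h′ ⟧
  I = λ g hE → ⟦ isHom? B K g hE ⟧
  H : (Fin k → Fin (nV K)) → (Fin n → Fin (nV K)) → Fin (nE K) → ℤ
  H s g y = ⟦ hit ⁅ g x ⁆ s ≟ˢ inc K y ⟧
  P : (Fin k → Fin (nV K)) → ℤ
  P s = prod (λ j → fs j (s j))
  Q : (Fin n → Fin (nV K)) → ℤ
  Q g = prod (λ y → φ′ y (g y))
  W : (Fin n → Fin (nV K)) → ℤ
  W g = sumF m (λ hE → I g hE * Q g)
  shuffle : ∀ h i p q → (h * i) * (p * q) ≡ (h * p) * (i * q)
  shuffle = solve-∀
  exchange : ∀ a b c → a * (b * c) ≡ b * (a * c)
  exchange = solve-∀
  isHom-split : ∀ s g y hE → I′ (s ⧺ g) (y VF.∷ hE) ≡ H s g y * I g hE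
  isHom-split s g y hE = ⟦⟧-× (isHom? (attach B x k) K (s ⧺ g) (y VF.∷ hE)) (hit ⁅ g x ⁆ s ≟ˢ inc K y) (isHom? B K g hE)
    (λ h → trans (sym (image-pad-inside s g x)) (h zero) , λ e → trans (sym (image-pad-outside s g (inc B e))) (h (suc e)))
    (λ { h₀ h zero → trans (image-pad-inside s g x) h₀ ; h₀ h (suc e) → trans (image-pad-outside s g (inc B e)) (h e) })

HomW-linear : ∀ B K x c a b (φ φ₁ φ₂ : Fin (nV B) → Fin (nV K) → ℤ) →
              (∀ y → y ≢ x → ∀ v → φ₁ y v ≡ φ y v × φ₂ y v ≡ φ y v) → (∀ v → c * φ x v ≡ a * φ₁ x v + b * φ₂ x v) →
              c * HomW B K φ ≡ a * HomW B K φ₁ + b * HomW B K φ₂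
HomW-linear B K x c a b φ φ₁ φ₂ off at =
  linF (nV B) _ _ _ λ hV → linF (nE B) _ _ _ λ hE →
    trans (exchange c ⟦ isHom? B K hV hE ⟧ (prod (λ y → φ y (hV y))))
    (trans (cong (⟦ isHom? B K hV hE ⟧ *_) (prod-linear _ _ _ x c a b (λ y y≢x → off y y≢x (hV y)) (at (hV x))))
      (distribute ⟦ isHom? B K hV hE ⟧ a (prod (λ y → φ₁ y (hV y))) b (prod (λ y → φ₂ y (hV y)))))
  where
  exchange : ∀ a b c → a * (b * c) ≡ b * (a * c)
  exchange = solve-∀
  distribute : ∀ i a p b q → i * (a * p + b * q) ≡ a * (i * p) + b * (i * q)
  distribute = solve-∀
  linF : ∀ n {m} (F F₁ F₂ : (Fin n → Fin m) → ℤ) → (∀ h → c * F h ≡ a * F₁ h + b * F₂ h) →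
         c * sumF n F ≡ a * sumF n F₁ + b * sumF n F₂
  linF n F F₁ F₂ eq = trans (sym (sumF-*ˡ n c F)) (trans (sumF-cong n eq)
    (trans (sumF-+ n (λ h → a * F₁ h) (λ h → b * F₂ h)) (cong₂ _+_ (sumF-*ˡ n a F₁) (sumF-*ˡ n b F₂))))

-- Homomorphism numbers as weighted counts

sumL : {A : Set} → List A → (A → ℤ) → ℤ
sumL []       f = 0ℤ
sumL (x ∷ xs) f = f x + sumL xs f

sumL-++ : ∀ {A : Set} (xs ys : List A) f → sumL (xs List.++ ys) f ≡ sumL xs f + sumL ys f
sumL-++ []       ys f = sym (+-identityˡ _)
sumL-++ (x ∷ xs) ys f = trans (cong (_+_ (f x)) (sumL-++ xs ys f)) (sym (+-assoc (f x) _ _))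

sumL-map : ∀ {A B : Set} (g : A → B) xs f → sumL (List.map g xs) f ≡ sumL xs (f ∘ g)
sumL-map g []       f = refl
sumL-map g (x ∷ xs) f = cong (_+_ (f (g x))) (sumL-map g xs f)

sumL-concatMap : ∀ {A B : Set} (g : A → List B) xs f → sumL (List.concatMap g xs) f ≡ sumL xs (λ x → sumL (g x) f)
sumL-concatMap g []       f = refl
sumL-concatMap g (x ∷ xs) f = trans (sumL-++ (g x) _ f) (cong (_+_ (sumL (g x) f)) (sumL-concatMap g xs f))

sumL-cong : ∀ {A : Set} (xs : List A) {f g : A → ℤ} → (∀ x → f x ≡ g x) → sumL xs f ≡ sumL xs g
sumL-cong []       eq = refl
sumL-cong (x ∷ xs) eq = cong₂ _+_ (eq x) (sumL-cong xs eq)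

sumL-cartesianProduct : ∀ {A B : Set} (xs : List A) (ys : List B) f →
                        sumL (List.cartesianProduct xs ys) f ≡ sumL xs (λ x → sumL ys (λ y → f (x , y)))
sumL-cartesianProduct []       ys f = refl
sumL-cartesianProduct (x ∷ xs) ys f = trans (sumL-++ (List.map (x ,_) ys) _ f)
  (cong₂ _+_ (sumL-map (x ,_) ys f) (sumL-cartesianProduct xs ys f))

sumL-tabulate : ∀ {A : Set} {n} (g : Fin n → A) f → sumL (List.tabulate g) f ≡ sum (f ∘ g)
sumL-tabulate {n = zero}  g f = sym (sum-0 _)
sumL-tabulate {n = suc n} g f = trans (cong (_+_ (f (g zero))) (sumL-tabulate (g ∘ suc) f)) (sym (sum-suc _))

sumL-filter : ∀ {A : Set} {P : A → Set} (P? : ∀ x → Dec (P x)) xs → + List.length (List.filter P? xs) ≡ sumL xs (λ x → ⟦ P? x ⟧)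
sumL-filter P? []       = refl
sumL-filter P? (x ∷ xs) with P? x
... | yes _ = cong (_+_ 1ℤ) (sumL-filter P? xs)
... | no _  = trans (sumL-filter P? xs) (sym (+-identityˡ _))

sumL-allFuns : ∀ n m (F : (Fin n → Fin m) → ℤ) → sumL (allFuns n m) F ≡ sumF n F
sumL-allFuns zero    m F = +-identityʳ _
sumL-allFuns (suc n) m F =
  trans (sumL-concatMap (λ y → List.map (λ g → y VF.∷ g) (allFuns n m)) (List.allFin m) F)
  (trans (sumL-tabulate id _)
    (sum-cong (λ y → trans (sumL-map (y VF.∷_) (allFuns n m) F) (sumL-allFuns n m (λ g → F (y VF.∷ g))))))

prod-ones : ∀ {n} → prod {n} (λ _ → 1ℤ) ≡ 1ℤ
prod-ones {zero}  = prod-0 _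
prod-ones {suc n} = trans (prod-suc _) (trans (*-identityˡ _) prod-ones)

Hom-HomW : ∀ F G → + Hom F G ≡ HomW F G (λ _ _ → 1ℤ)
Hom-HomW F G = begin
  + Hom F G
    ≡⟨ sumL-filter (λ p → isHom? F G (proj₁ p) (proj₂ p)) (List.cartesianProduct (allFuns (nV F) (nV G)) (allFuns (nE F) (nE G))) ⟩
  sumL (List.cartesianProduct (allFuns (nV F) (nV G)) (allFuns (nE F) (nE G))) (λ p → ⟦ isHom? F G (proj₁ p) (proj₂ p) ⟧)
    ≡⟨ sumL-cartesianProduct (allFuns (nV F) (nV G)) (allFuns (nE F) (nE G)) (λ p → ⟦ isHom? F G (proj₁ p) (proj₂ p) ⟧) ⟩
  sumL (allFuns (nV F) (nV G)) (λ h → sumL (allFuns (nE F) (nE G)) (λ h′ → ⟦ isHom? F G h h′ ⟧))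
    ≡⟨ trans (sumL-cong (allFuns (nV F) (nV G)) (λ h → sumL-allFuns (nE F) (nE G) (λ h′ → ⟦ isHom? F G h h′ ⟧))) (sumL-allFuns (nV F) (nV G) _) ⟩
  sumF (nV F) (λ h → sumF (nE F) (λ h′ → ⟦ isHom? F G h h′ ⟧))
    ≡⟨ sumF-cong (nV F) (λ h → sumF-cong (nE F) (λ h′ → sym (trans (cong (⟦ isHom? F G h h′ ⟧ *_) (prod-ones {nV F})) (*-identityʳ _)))) ⟩
  HomW F G (λ _ _ → 1ℤ) ∎

-- Colours determine homomorphism counts

point : Hypergraph
point = record { nV = 1 ; nE = 0 ; inc = λ () ; inc-nonempty = λ () }

-- The case k = 0 is included because Berge-acyclic hypergraphs can have one-vertex edges, even
-- parallel ones.
data Built : Hypergraph → Set where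
  start : Built point
  grow  : ∀ {B} → Built B → ∀ x k → Built (attach B x k)

HomW-point : ∀ K φ → HomW point K φ ≡ sum (φ zero)
HomW-point K φ = sum-cong λ v → begin
  ⟦ isHom? point K (v VF.∷ λ ()) (λ ()) ⟧ * prod (λ x → φ x ((v VF.∷ λ ()) x))
    ≡⟨ cong₂ _*_ (⟦⟧-true (isHom? point K (v VF.∷ λ ()) (λ ())) (λ ())) (trans (prod-suc _) (cong (φ zero v *_) (prod-0 _))) ⟩
  1ℤ * (φ zero v * 1ℤ)  ≡⟨ trans (*-identityˡ _) (*-identityʳ _) ⟩
  φ zero v ∎

update : ∀ {n} {A : Set} → Fin n → A → (Fin n → A) → Fin n → A
update x a φ y with y ≟ᶠ x
... | yes _ = a
... | no  _ = φ y

update-at : ∀ {n} {A : Set} (x : Fin n) (a : A) φ → update x a φ x ≡ a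
update-at x a φ with x ≟ᶠ x
... | yes _ = refl
... | no ¬e = ⊥-elim (¬e refl)

update-off : ∀ {n} {A : Set} (x : Fin n) (a : A) φ y → y ≢ x → update x a φ y ≡ φ y
update-off x a φ y y≢x with y ≟ᶠ x
... | yes e = ⊥-elim (y≢x e)
... | no  _ = refl

-- The attachment identity read from the larger hypergraph to the smaller: arbitrary weights are
-- pushed down onto `B`.
HomW-attach′ : ∀ B K x k (φ : Fin (k ℕ.+ nV B) → Fin (nV K) → ℤ) →
               HomW (attach B x k) K φ ≡
               HomW B K (update x (λ v → ψ K (φ ∘ (_↑ˡ nV B)) v * φ (k ↑ʳ x) v) (φ ∘ (k ↑ʳ_)))
HomW-attach′ B K x k φ = trans
  (HomW-cong (attach B x k) K (λ i v → parts i (split k i) v))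
  (HomW-attach B K x (φ ∘ (_↑ˡ nV B)) (update x χ (φ ∘ (k ↑ʳ_))) (φ ∘ (k ↑ʳ_))
    (λ y y≢x v → cong (λ f → f v) (update-off x χ (φ ∘ (k ↑ʳ_)) y y≢x))
    (λ v → cong (λ f → f v) (update-at x χ (φ ∘ (k ↑ʳ_)))))
  where
  χ : Fin (nV K) → ℤ
  χ v = ψ K (φ ∘ (_↑ˡ nV B)) v * φ (k ↑ʳ x) v
  parts : ∀ i → Split k i → ∀ v → φ i v ≡ ((φ ∘ (_↑ˡ nV B)) ⧺ (φ ∘ (k ↑ʳ_))) i v
  parts _ (new j) v = cong (λ f → f v) (sym (⧺-↑ˡ (φ ∘ (_↑ˡ nV B)) (φ ∘ (k ↑ʳ_)) j))
  parts _ (old y) v = cong (λ f → f v) (sym (⧺-↑ʳ k (φ ∘ (_↑ˡ nV B)) (φ ∘ (k ↑ʳ_)) y))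

mset-map : ∀ {a b} {P : Fin a → Set} {Q : Fin b → Set} {R R′ : Fin a → Fin b → Set} →
           (∀ {x y} → R x y → R′ x y) → MSetEq P Q R → MSetEq P Q R′
mset-map f (σ , r) = σ , f ∘ r

-- The bijection is `σ`, followed by the inverse of `σ′`, followed by `σ″`.
mset-zigzag : ∀ {a b} {P P′ : Fin a → Set} {Q Q′ : Fin b → Set} {R : Fin a → Fin b → Set} → Zigzag R →
              MSetEq P Q R → MSetEq P′ Q R → MSetEq P′ Q′ R → MSetEq P Q′ R
mset-zigzag {P = P} {P′} {Q} {Q′} {R} zz (σ , r) (σ′ , r′) (σ″ , r″) = mk⤖ {to = to} (inj , surj) , related
  where
  open Bijection using (bijective) renaming (to to fun)
  back : Σ _ Q → Σ _ P′
  back y = proj₁ (proj₂ (bijective σ′) y)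
  fun-back : ∀ y → fun σ′ (back y) ≡ y
  fun-back y = proj₂ (proj₂ (bijective σ′) y) refl
  to : Σ _ P → Σ _ Q′
  to x = fun σ″ (back (fun σ x))
  related : ∀ x → R (proj₁ x) (proj₁ (to x))
  related x = zz (r x) (subst (R _ ∘ proj₁) (fun-back (fun σ x)) (r′ (back (fun σ x)))) (r″ (back (fun σ x)))
  inj : ∀ {x x′} → to x ≡ to x′ → x ≡ x′
  inj e = proj₁ (bijective σ)
    (trans (sym (fun-back _)) (trans (cong (fun σ′) (proj₁ (bijective σ″) e)) (fun-back _)))
  surj : ∀ z → ∃ λ x → ∀ {x′} → x′ ≡ x → to x′ ≡ z
  surj z =
    let w , w↦z = proj₂ (bijective σ″) z
        x , x↦w = proj₂ (bijective σ) (fun σ′ w)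
    in x , λ { refl → w↦z (proj₁ (bijective σ′) (trans (fun-back _) (x↦w refl))) }

module _ (G H : Hypergraph) where

  SameEdge : ℕ → Fin (nE G) → Fin (nE H) → Set
  SameEdge i e e′ = MSetEq (λ u → u ∈ inc G e) (λ u → u ∈ inc H e′) (SameColour i G H)

  colour-zigzag : ∀ i → Zigzag (SameColour i G H)
  colour-zigzag zero    _ _ _ = tt
  colour-zigzag (suc i) = mset-zigzag {R = SameEdge i} (mset-zigzag {R = SameColour i G H} (colour-zigzag i))

  colour-coarsen : ∀ i {v w} → SameColour (suc i) G H v w → SameColour i G H v w
  colour-coarsen zero    _ = tt
  colour-coarsen (suc i) = mset-map {R = SameEdge (suc i)} {R′ = SameEdge i}
    (mset-map {R = SameColour (suc i) G H} {R′ = SameColour i G H} (colour-coarsen i))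

  Respects : ℕ → (Fin (nV G) → ℤ) → (Fin (nV H) → ℤ) → Set
  Respects i f g = ∀ {v w} → SameColour i G H v w → f v ≡ g w

  -- Equal colours at level i + 1 match the edges at v with those at w, and matched edges have equal
  -- multisets of level-i colours, so `Φ-rooted` equates their contributions. The roots themselves
  -- agree at level i by coarsening.
  ψ-respects : ∀ i {k} (fs : Fin k → Fin (nV G) → ℤ) (gs : Fin k → Fin (nV H) → ℤ) →
               (∀ j → Respects i (fs j) (gs j)) → Respects (suc i) (ψ G fs) (ψ H gs)
  ψ-respects i fs gs resp {v} {w} same =
    matching-sum (mset⇒matching (λ e → v ∈? inc G e) []=-irrelevant []=-irrelevant same)
      (λ e → v ∈? inc G e) (λ e → w ∈? inc H e) _ _
      (λ {e} {e′} v∈e w∈e′ m → Φ-rooted G H (colour-zigzag i)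
        (mset⇒matching (λ u → u ∈? inc G e) []=-irrelevant []=-irrelevant m) v∈e w∈e′ (colour-coarsen i same) fs gs resp)
      (λ e v∉e → Φ-outside G e ⁅ v ⁆ fs (x∈⁅x⁆ v) v∉e) (λ e w∉e → Φ-outside H e ⁅ w ⁆ gs (x∈⁅x⁆ w) w∉e)

  -- The level rises by one with each edge peeled off, which is why i is arbitrary here. At the
  -- single remaining vertex the two sums are equated by the multiset equality of colours at the
  -- level reached.
  HomW-respects : NotDistinguished G H → ∀ {B} → Built B → ∀ i φ φ′ →
                  (∀ x → Respects i (φ x) (φ′ x)) → HomW B G φ ≡ HomW B H φ′
  HomW-respects nd start i φ φ′ resp = begin
    HomW point G φ  ≡⟨ HomW-point G φ ⟩
    sum (φ zero)    ≡⟨ matching-sum (mset⇒matching (λ _ → yes tt) (λ _ _ → refl) (λ _ _ → refl) (nd i)) (λ _ → yes tt) (λ _ → yes tt) _ _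
                         (λ _ _ same → resp zero same) (λ _ ¬⊤ → ⊥-elim (¬⊤ tt)) (λ _ ¬⊤ → ⊥-elim (¬⊤ tt)) ⟩
    sum (φ′ zero)   ≡⟨ HomW-point H φ′ ⟨
    HomW point H φ′ ∎
  HomW-respects nd (grow {B} b x k) i φ φ′ resp = begin
    HomW (attach B x k) G φ   ≡⟨ HomW-attach′ B G x k φ ⟩
    HomW B G χ                ≡⟨ HomW-respects nd b (suc i) χ χ′ resp′ ⟩
    HomW B H χ′               ≡⟨ HomW-attach′ B H x k φ′ ⟨
    HomW (attach B x k) H φ′  ∎
    where
    χ  = update x (λ v → ψ G (φ ∘ (_↑ˡ nV B)) v * φ (k ↑ʳ x) v) (φ ∘ (k ↑ʳ_))
    χ′ = update x (λ v → ψ H (φ′ ∘ (_↑ˡ nV B)) v * φ′ (k ↑ʳ x) v) (φ′ ∘ (k ↑ʳ_))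
    resp′ : ∀ y → Respects (suc i) (χ y) (χ′ y)
    resp′ y same with y ≟ᶠ x
    ... | yes _ = cong₂ _*_ (ψ-respects i (φ ∘ (_↑ˡ nV B)) (φ′ ∘ (_↑ˡ nV B)) (λ j → resp (j ↑ˡ nV B)) same) (resp (k ↑ʳ x) (colour-coarsen i same))
    ... | no  _ = resp (k ↑ʳ y) (colour-coarsen i same)

-- Walks and cycles

adj-sym : ∀ H {x y} → Adj H x y → Adj H y x
adj-sym H {inj₁ _} {inj₂ _} a = a
adj-sym H {inj₂ _} {inj₁ _} a = a

walk-++ : ∀ {H x y z} → Walk H x y → Walk H y z → Walk H x z
walk-++ here       w = w
walk-++ (step a v) w = step a (walk-++ v w)

walk-sym : ∀ {H x y} → Walk H x y → Walk H y x
walk-sym here           = here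
walk-sym {H} (step a w) = walk-++ (walk-sym w) (step (adj-sym H a) here)

connected-from : ∀ {H} r → (∀ x → Walk H x r) → Connected H
connected-from r w x y = walk-++ (w x) (walk-sym (w y))

walk-map : ∀ {F G} (f : Node F → Node G) → (∀ x y → Adj F x y → Adj G (f x) (f y)) → ∀ {x y} → Walk F x y → Walk G (f x) (f y)
walk-map f hom here       = here
walk-map f hom (step a w) = step (hom _ _ a) (walk-map f hom w)

chain-map : ∀ {F G} (f : Node F → Node G) → (∀ x y → Adj F x y → Adj G (f x) (f y)) → ∀ {x} ys → Chain F x ys → Chain G (f x) (map f ys)
chain-map f hom []       tt      = tt
chain-map f hom (y ∷ ys) (a , c) = hom _ _ a , chain-map f hom ys c

chain-unmap : ∀ {F G} (f : Node F → Node G) → (∀ x y → Adj G (f x) (f y) → Adj F x y) → ∀ {x} ys → Chain G (f x) (map f ys) → Chain F x ys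
chain-unmap f hom []       tt      = tt
chain-unmap f hom (y ∷ ys) (a , c) = hom _ _ a , chain-unmap f hom ys c

chain-++ : ∀ {H x} ys {y zs} → Chain H x (ys ++ [ y ]) → Chain H y zs → Chain H x (ys ++ y ∷ zs)
chain-++ []       (a , tt) c = a , c
chain-++ (_ ∷ ys) (a , b)  c = a , chain-++ ys b c

-- Moves the base point one step along the cycle, so that the former base point becomes an interior
-- node, to which `passes` applies.
rotate : ∀ {H x y ys} → Unique (x ∷ y ∷ ys) → Chain H x ((y ∷ ys) ++ [ x ]) →
         Unique (y ∷ (ys ++ [ x ])) × Chain H y ((ys ++ [ x ]) ++ [ y ])
rotate {H} {x} {y} {ys} u@((_ ∷ x≢) ∷ (y≢ ∷ uys)) (a , c) =
  unique-++⁺ {xs = y ∷ ys} (y≢ ∷ uys) ([] ∷ []) (λ { (v∈ , here refl) → Unique[x∷xs]⇒x∉xs u v∈ }) ,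
  subst (Chain H y) (sym (++-assoc ys [ x ] [ y ])) (chain-++ ys c (a , tt))

-- The walk a, bs, x passes through z and leaves it by another node than it came from.
passes : ∀ {H a x} bs → Unique (a ∷ bs) → x ∉ˡ bs → (a ≢ x ⊎ 2 ℕ.≤ length bs) → Chain H a (bs ++ [ x ]) →
         ∀ {z} → z ∈ˡ bs → ∃₂ λ p q → p ≢ q × Adj H z p × Adj H z q × p ∈ˡ a ∷ bs ++ [ x ] × q ∈ˡ a ∷ bs ++ [ x ]
passes {H} (b ∷ [])      u x∉ (inj₁ a≢x)       (α , β , tt) (here refl) =
  _ , _ , a≢x , adj-sym H α , β , here refl , there (there (here refl))
passes {H} (b ∷ [])      u x∉ (inj₂ (ℕ.s≤s ())) c           (here refl)
passes {H} (b ∷ c ∷ bs) u x∉ _                 (α , β , _)  (here refl) =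
  _ , _ , (λ { refl → Unique[x∷xs]⇒x∉xs u (there (here refl)) }) , adj-sym H α , β , here refl , there (there (here refl))
passes {H} (b ∷ bs)      (_ ∷ u) x∉ _          (_ , c)      (there z∈) =
  let p , q , p≢q , zp , zq , p∈ , q∈ = passes bs u (x∉ ∘ there) (inj₁ λ { refl → x∉ (here refl) }) c z∈
  in p , q , p≢q , zp , zq , there p∈ , there q∈

cycle-nodes : ∀ {H} → Cycle H → List (Node H)
cycle-nodes (x , ys , _) = x ∷ ys

-- The only property of cycles used for attaching: a node without two different neighbours on the
-- cycle cannot lie on it.
neighbours : ∀ {H} (c : Cycle H) {z} → z ∈ˡ cycle-nodes c →
             ∃₂ λ p q → p ≢ q × Adj H z p × Adj H z q × p ∈ˡ cycle-nodes c × q ∈ˡ cycle-nodes c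
neighbours {H} (x , ys , len , u , ch) (there z∈) =
  let p , q , p≢q , zp , zq , p∈ , q∈ = passes ys u (Unique[x∷xs]⇒x∉xs u) (inj₂ len) ch z∈
  in p , q , p≢q , zp , zq , unclose p∈ , unclose q∈
  where
  unclose : ∀ {p} → p ∈ˡ x ∷ ys ++ [ x ] → p ∈ˡ x ∷ ys
  unclose (here e)   = here e
  unclose (there p∈) with ∈-++⁻ ys p∈
  ... | inj₁ p∈ys      = there p∈ys
  ... | inj₂ (here e)  = here e
neighbours {H} (x , y ∷ ys , ℕ.s≤s len , u , ch) (here refl) =
  let u′ , ch′ = rotate u ch
      p , q , p≢q , zp , zq , p∈ , q∈ = passes (ys ++ [ x ]) u′ (Unique[x∷xs]⇒x∉xs u′) (inj₂ len′) ch′ (∈-++⁺ʳ ys (here refl))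
  in p , q , p≢q , zp , zq , unclose p∈ , unclose q∈
  where
  len′ : 2 ℕ.≤ length (ys ++ [ x ])
  len′ = subst (2 ℕ.≤_) (sym (trans (length-++ ys) (ℕ.+-comm (length ys) 1))) (ℕ.s≤s len)
  unclose : ∀ {p} → p ∈ˡ y ∷ (ys ++ [ x ]) ++ [ y ] → p ∈ˡ x ∷ y ∷ ys
  unclose (here e) = there (here e)
  unclose (there p∈) with ∈-++⁻ (ys ++ [ x ]) p∈
  ... | inj₂ (here e) = there (here e)
  ... | inj₁ p∈′ with ∈-++⁻ ys p∈′
  ...   | inj₁ p∈ys     = there (there p∈ys)
  ...   | inj₂ (here e) = here e

-- Attaching an edge preserves connectedness and acyclicity

point-connected : Connected point
point-connected = connected-from (inj₁ zero) λ { (inj₁ zero) → here ; (inj₁ (suc ())) ; (inj₂ ()) }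

point-acyclic : BergeAcyclic point
point-acyclic c with neighbours c (here refl)
point-acyclic (inj₁ _ , _) | inj₂ () , _
point-acyclic (inj₂ () , _) | _

module _ (B : Hypergraph) (x : Fin (nV B)) (k : ℕ) where

  embed : Node B → Node (attach B x k)
  embed (inj₁ v) = inj₁ (k ↑ʳ v)
  embed (inj₂ e) = inj₂ (suc e)

  embed-adj⁺ : ∀ y z → Adj B y z → Adj (attach B x k) (embed y) (embed z)
  embed-adj⁺ (inj₁ _) (inj₂ _) a = pad-old⁺ k a
  embed-adj⁺ (inj₂ _) (inj₁ _) a = pad-old⁺ k a

  embed-adj⁻ : ∀ y z → Adj (attach B x k) (embed y) (embed z) → Adj B y z
  embed-adj⁻ (inj₁ _) (inj₂ _) a = pad-old⁻ k a
  embed-adj⁻ (inj₂ _) (inj₁ _) a = pad-old⁻ k a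

  attach-connected : Connected B → Connected (attach B x k)
  attach-connected conn = connected-from (embed (inj₁ x)) toRoot
    where
    viaB : ∀ y → Walk (attach B x k) (embed y) (embed (inj₁ x))
    viaB y = walk-map embed embed-adj⁺ (conn y (inj₁ x))
    viaVertex : ∀ i → Split k i → Walk (attach B x k) (inj₁ i) (embed (inj₁ x))
    viaVertex _ (new j) = step {y = inj₂ zero} (pad-new⁺ j) (step (pad-old⁺ k (x∈⁅x⁆ x)) here)
    viaVertex _ (old v) = viaB (inj₁ v)
    toRoot : ∀ y → Walk (attach B x k) y (embed (inj₁ x))
    toRoot (inj₁ i)       = viaVertex i (split k i)
    toRoot (inj₂ zero)    = step (pad-old⁺ k (x∈⁅x⁆ x)) here
    toRoot (inj₂ (suc e)) = viaB (inj₂ e)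

  module _ (c : Cycle (attach B x k)) where

    -- The only neighbour of a new vertex is the new edge.
    new-vertex-∉ : ∀ j → inj₁ (j ↑ˡ nV B) ∉ˡ cycle-nodes c
    new-vertex-∉ j z∈ with neighbours c z∈
    ... | inj₂ zero    , inj₂ zero    , p≢q , _ = p≢q refl
    ... | inj₂ (suc _) , _            , _ , a , _     = pad-new⁻ j a
    ... | inj₂ zero    , inj₂ (suc _) , _ , _ , a , _ = pad-new⁻ j a

    -- With the new vertices excluded, x is the only possible neighbour of the new edge on a cycle.
    new-edge-∉ : inj₂ zero ∉ˡ cycle-nodes c
    new-edge-∉ z∈ with neighbours c z∈
    ... | inj₁ p , inj₁ q , p≢q , zp , zq , p∈ , q∈ = p≢q (cong inj₁ (trans (isRoot p zp p∈) (sym (isRoot q zq q∈))))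
      where
      isRoot : ∀ p → p ∈ pad inside k ⁅ x ⁆ → inj₁ p ∈ˡ cycle-nodes c → p ≡ k ↑ʳ x
      isRoot p zp p∈ with split k p
      ... | new j = ⊥-elim (new-vertex-∉ j p∈)
      ... | old v = cong (k ↑ʳ_) (x∈⁅y⁆⇒x≡y x (pad-old⁻ k zp))

    cycle-node-old : ∀ z → z ∈ˡ cycle-nodes c → ∃ λ y → z ≡ embed y
    cycle-node-old (inj₁ i) z∈ with split k i
    ... | new j = ⊥-elim (new-vertex-∉ j z∈)
    ... | old v = inj₁ v , refl
    cycle-node-old (inj₂ zero)    z∈ = ⊥-elim (new-edge-∉ z∈)
    cycle-node-old (inj₂ (suc e)) z∈ = inj₂ e , refl

  unembed : ∀ zs → (∀ z → z ∈ˡ zs → ∃ λ y → z ≡ embed y) → ∃ λ ys → zs ≡ map embed ys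
  unembed []       f = [] , refl
  unembed (z ∷ zs) f = let y , e = f z (here refl) ; ys , e′ = unembed zs (λ z → f z ∘ there) in y ∷ ys , cong₂ _∷_ e e′

  attach-acyclic : BergeAcyclic B → BergeAcyclic (attach B x k)
  attach-acyclic acyc c@(z , zs , len , u , ch) with unembed (z ∷ zs) (cycle-node-old c)
  ... | y ∷ ys , refl = acyc (y , ys , subst (2 ℕ.≤_) (length-map embed ys) len , unique-map⁻ u ,
      chain-unmap embed embed-adj⁻ (ys ++ [ y ]) (subst (Chain (attach B x k) (embed y)) (sym (map-++ embed ys [ y ])) ch))

built-connected : ∀ {B} → Built B → Connected B
built-connected start          = point-connected
built-connected (grow {B} b x k) = attach-connected B x k (built-connected b)

-- Loops are erased from the end of the walk backwards: when the start x recurs on the simple path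
-- already found for the rest, that path is cut down to its part from x on.
simple-path : ∀ {H} (_≟_ : ∀ (x y : Node H) → Dec (x ≡ y)) {x z} → Walk H x z → x ≢ z →
              ∃ λ ys → Unique (x ∷ ys ++ [ z ]) × Chain H x (ys ++ [ z ])
simple-path {H} _≟_ here x≢z = ⊥-elim (x≢z refl)
simple-path {H} _≟_ {x} {z} (step {y = y} a w) x≢z with y ≟ z
... | yes refl = [] , ((x≢z ∷ []) ∷ [] ∷ []) , a , tt
... | no y≢z = let ys , u , c = simple-path _≟_ w y≢z in extend a ys u c
  where
  extend : ∀ {y} → Adj H x y → ∀ ys → Unique (y ∷ ys ++ [ z ]) → Chain H y (ys ++ [ z ]) →
           ∃ λ ys → Unique (x ∷ ys ++ [ z ]) × Chain H x (ys ++ [ z ])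
  extend {y} a ys u c with Any.any? (x ≟_) (y ∷ ys ++ [ z ])
  ... | no x∉ = y ∷ ys , (¬Any⇒All¬ _ x∉ ∷ u) , a , c
  ... | yes x∈ = cut y ys u c x∈
    where
    cut : ∀ y ys → Unique (y ∷ ys ++ [ z ]) → Chain H y (ys ++ [ z ]) → Any (x ≡_) (y ∷ ys ++ [ z ]) →
          ∃ λ ys → Unique (x ∷ ys ++ [ z ]) × Chain H x (ys ++ [ z ])
    cut y ys       u       c       (here refl) = ys , u , c
    cut y []       u       c       (there (here e)) = ⊥-elim (x≢z e)
    cut y (b ∷ ys) (_ ∷ u) (_ , c) (there x∈)  = cut b ys u c x∈

-- Exploring a connected Berge-acyclic hypergraph

unique-lookup-injective : ∀ {A : Set} {xs : List A} → Unique xs → ∀ i j → List.lookup xs i ≡ List.lookup xs j → i ≡ j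
unique-lookup-injective (x≢ ∷ u) zero    zero    e = refl
unique-lookup-injective (x≢ ∷ u) zero    (suc j) e = ⊥-elim (All.lookup x≢ (∈-lookup j) e)
unique-lookup-injective (x≢ ∷ u) (suc i) zero    e = ⊥-elim (All.lookup x≢ (∈-lookup i) (sym e))
unique-lookup-injective (x≢ ∷ u) (suc i) (suc j) e = cong suc (unique-lookup-injective u i j e)

module Others {n} (p : Subset n) (v : Fin n) where

  other? : ∀ u → Dec (u ∈ p × u ≢ v)
  other? u = (u ∈? p) ×-dec ¬? (u ≟ᶠ v)

  others : List (Fin n)
  others = List.filter other? (List.allFin n)

  size : ℕ
  size = length others

  other : Fin size → Fin n
  other = List.lookup others

  other-injective : ∀ i j → other i ≡ other j → i ≡ j
  other-injective = unique-lookup-injective (unique-filter⁺ other? (allFin⁺ n))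

  other-∈ : ∀ j → other j ∈ p
  other-∈ j = proj₁ (proj₂ (∈-filter⁻ other? {xs = List.allFin n} (∈-lookup j)))

  other-≢ : ∀ j → other j ≢ v
  other-≢ j = proj₂ (proj₂ (∈-filter⁻ other? {xs = List.allFin n} (∈-lookup j)))

  other-surjective : ∀ {u} → u ∈ p → u ≢ v → ∃ λ j → other j ≡ u
  other-surjective {u} u∈ u≢ = let u∈xs = ∈-filter⁺ other? (∈-allFin u) (u∈ , u≢) in index u∈xs , sym (lookup-index u∈xs)

  hit-others : v ∈ p → hit ⁅ v ⁆ other ≡ p
  hit-others v∈ = ⊆-antisym (λ y∈ → fwd (∈-hit⁻ ⁅ v ⁆ other y∈)) (λ y∈ → ∈-hit⁺ other (bwd y∈))
    where
    fwd : ∀ {y} → y ∈ ⁅ v ⁆ ⊎ (∃ λ j → other j ≡ y) → y ∈ p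
    fwd (inj₁ y∈)         = subst (_∈ p) (sym (x∈⁅y⁆⇒x≡y v y∈)) v∈
    fwd (inj₂ (j , refl)) = other-∈ j
    bwd : ∀ {y} → y ∈ p → y ∈ ⁅ v ⁆ ⊎ (∃ λ j → other j ≡ y)
    bwd {y} y∈ with y ≟ᶠ v
    ... | yes refl = inj₁ (x∈⁅x⁆ y)
    ... | no y≢    = inj₂ (other-surjective y∈ y≢)

-- A hypertree embedded in `B`. As `hom` asks for equality of images, every vertex of an explored
-- edge is itself explored.
record Exploration (B : Hypergraph) : Set where
  field
    part  : Hypergraph
    built : Built part
    ι     : Fin (nV part) → Fin (nV B)
    κ     : Fin (nE part) → Fin (nE B)
    ι-inj : ∀ {x y} → ι x ≡ ι y → x ≡ y
    κ-inj : ∀ {x y} → κ x ≡ κ y → x ≡ y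
    hom   : IsHom part B ι κ

module _ {B : Hypergraph} (acyc : BergeAcyclic B) where

  module _ (X : Exploration B) where
    open Exploration X

    node : Node part → Node B
    node (inj₁ x) = inj₁ (ι x)
    node (inj₂ e) = inj₂ (κ e)

    node-inj : ∀ {y z} → node y ≡ node z → y ≡ z
    node-inj {inj₁ _} {inj₁ _} e = cong inj₁ (ι-inj (inj₁-injective e))
    node-inj {inj₂ _} {inj₂ _} e = cong inj₂ (κ-inj (inj₂-injective e))

    node-adj : ∀ y z → Adj part y z → Adj B (node y) (node z)
    node-adj (inj₁ x) (inj₂ e) a = subst (ι x ∈_) (hom e) (∈-image⁺ ι a)
    node-adj (inj₂ e) (inj₁ x) a = subst (ι x ∈_) (hom e) (∈-image⁺ ι a)

    -- Otherwise the path between x and x′ in the explored part closes to a cycle through e.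
    fresh : ∀ {e} → (∀ e′ → κ e′ ≢ e) → ∀ {x x′} → ι x ∈ inc B e → ι x′ ∈ inc B e → x ≡ x′
    fresh {e} e∉ {x} {x′} x∈ x′∈ with x ≟ᶠ x′
    ... | yes x≡x′ = x≡x′
    ... | no  x≢x′ = ⊥-elim (acyc (inj₂ e , inj₁ (ι x) ∷ path , length-path , unique , x∈ , chain))
      where
      simple = simple-path (⊎-≡-dec _≟ᶠ_ _≟ᶠ_) (built-connected built (inj₁ x) (inj₁ x′)) (x≢x′ ∘ inj₁-injective)
      ys = proj₁ simple
      path = map node ys ++ [ inj₁ (ι x′) ]
      path≡ : map node (ys ++ [ inj₁ x′ ]) ≡ path
      path≡ = map-++ node ys [ inj₁ x′ ]
      length-path : 2 ℕ.≤ suc (length path)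
      length-path = ℕ.s≤s (subst (1 ℕ.≤_) (sym (trans (length-++ (map node ys)) (ℕ.+-comm _ 1))) (ℕ.s≤s ℕ.z≤n))
      unique : Unique (inj₂ e ∷ inj₁ (ι x) ∷ path)
      unique = subst (λ zs → Unique (inj₂ e ∷ inj₁ (ι x) ∷ zs)) path≡
        (¬Any⇒All¬ _ e∉path ∷ unique-map⁺ node-inj (proj₁ (proj₂ simple)))
        where
        e∉path : inj₂ e ∉ˡ map node (inj₁ x ∷ ys ++ [ inj₁ x′ ])
        e∉path e∈ with ∈-map⁻ node e∈
        ... | inj₂ e′ , _ , eq = e∉ e′ (sym (inj₂-injective eq))
        ... | inj₁ _  , _ , ()
      chain : Chain B (inj₁ (ι x)) (path ++ [ inj₂ e ])
      chain = subst (Chain B (inj₁ (ι x))) (sym (++-assoc (map node ys) _ _))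
        (chain-++ (map node ys) (subst (Chain B (inj₁ (ι x))) path≡ (chain-map node node-adj (ys ++ [ inj₁ x′ ]) (proj₂ (proj₂ simple))))
          (x′∈ , tt))

    -- By `fresh` the new edge meets the explored part in ι x alone, so its other vertices are
    -- really new and ι stays injective.
    extend : ∀ e x → (∀ e′ → κ e′ ≢ e) → ι x ∈ inc B e → Exploration B
    extend e x e∉ x∈ = record
      { part = attach part x size ; built = grow built x size ; ι = other ⧺ ι ; κ = e VF.∷ κ
      ; ι-inj = λ {y} {z} → inj (split size y) (split size z)
      ; κ-inj = λ { {zero} {zero} _ → refl ; {zero} {suc e′} eq → ⊥-elim (e∉ e′ (sym eq))
                  ; {suc e′} {zero} eq → ⊥-elim (e∉ e′ eq) ; {suc _} {suc _} eq → cong suc (κ-inj eq) }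
      ; hom = λ { zero → trans (image-pad-inside other ι x) (hit-others x∈) ; (suc e′) → trans (image-pad-outside other ι (inc part e′)) (hom e′) } }
      where
      open Others (inc B e) (ι x)
      inj : ∀ {y z} → Split size y → Split size z → (other ⧺ ι) y ≡ (other ⧺ ι) z → y ≡ z
      inj (new i) (new j) eq = cong (_↑ˡ nV part) (other-injective i j (trans (sym (⧺-↑ˡ other ι i)) (trans eq (⧺-↑ˡ other ι j))))
      inj (old y) (old z) eq = cong (size ↑ʳ_) (ι-inj (trans (sym (⧺-↑ʳ size other ι y)) (trans eq (⧺-↑ʳ size other ι z))))
      inj (new i) (old z) eq = ⊥-elim (clash i z (trans (sym (⧺-↑ˡ other ι i)) (trans eq (⧺-↑ʳ size other ι z))))
        where
        clash : ∀ i z → other i ≢ ι z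
        clash i z eq = other-≢ i (trans eq (cong ι (sym (fresh e∉ x∈ (subst (_∈ inc B e) eq (other-∈ i))))))
      inj (old z) (new i) eq = sym (inj (new i) (old z) (sym eq))

    Closed : Set
    Closed = ∀ e x → ι x ∈ inc B e → ∃ λ e′ → κ e′ ≡ e

    closed? : Closed ⊎ ∃₂ λ e x → (∀ e′ → κ e′ ≢ e) × ι x ∈ inc B e
    closed? with any? (λ e → any? (λ x → all? (λ e′ → ¬? (κ e′ ≟ᶠ e)) ×-dec (ι x ∈? inc B e)))
    ... | yes (e , x , e∉ , x∈) = inj₂ (e , x , e∉ , x∈)
    ... | no none = inj₁ λ e x x∈ → decidable-stable (any? (λ e′ → κ e′ ≟ᶠ e)) λ no-κ → none (e , x , (λ e′ eq → no-κ (e′ , eq)) , x∈)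

  -- Each extension adds an edge, and injectivity of κ bounds the number of explored edges by
  -- `nE B`. Hence at d = 0 a further extension would have too many edges.
  explore : ∀ d (X : Exploration B) → nE B ℕ.≤ d ℕ.+ nE (Exploration.part X) → Σ (Exploration B) Closed
  explore d X bound with closed? X
  ... | inj₁ closed = X , closed
  explore zero    X bound | inj₂ (e , x , e∉ , x∈) =
    ⊥-elim (ℕ.<-irrefl refl (ℕ.≤-trans (injective⇒≤ (Exploration.κ-inj (extend X e x e∉ x∈))) bound))
  explore (suc d) X bound | inj₂ (e , x , e∉ , x∈) =
    explore d (extend X e x e∉ x∈) (subst (nE B ℕ.≤_) (sym (ℕ.+-suc d _)) bound)

  begin-at : Fin (nV B) → Exploration B
  begin-at v = record { part = point ; built = start ; ι = λ _ → v ; κ = λ ()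
    ; ι-inj = λ { {zero} {zero} _ → refl ; {zero} {suc ()} ; {suc ()} } ; κ-inj = λ { {()} } ; hom = λ () }

  built-root : ∀ {B} → Built B → Fin (nV B)
  built-root start        = zero
  built-root (grow b x k) = k ↑ʳ x

  module _ (conn : Connected B) (X : Exploration B) (closed : Closed X) where
    open Exploration X

    Covered : Node B → Set
    Covered y = ∃ λ x → node X x ≡ y

    -- Leaving a vertex for an edge uses closedness; leaving an edge for a vertex uses that the
    -- image of an explored edge is the whole edge.
    covered-step : ∀ y z → Adj B y z → Covered y → Covered z
    covered-step (inj₁ _) (inj₂ e) a (inj₁ x , refl) = let e′ , eq = closed e x a in inj₂ e′ , cong inj₂ eq
    covered-step (inj₂ _) (inj₁ v) a (inj₂ e , refl) =
      let x , _ , eq = ∈-image⁻ ι (subst (v ∈_) (sym (hom e)) a) in inj₁ x , cong inj₁ eq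

    covered-walk : ∀ {y z} → Walk B y z → Covered y → Covered z
    covered-walk here       c = c
    covered-walk (step a w) c = covered-walk w (covered-step _ _ a c)

    covered : ∀ y → Covered y
    covered y = covered-walk (conn (inj₁ (ι (built-root built))) y) (inj₁ (built-root built) , refl)

    ι-onto : ∀ v → ∃ λ x → ι x ≡ v
    ι-onto v with covered (inj₁ v)
    ... | inj₁ x , refl = x , refl

    κ-onto : ∀ e → ∃ λ x → κ x ≡ e
    κ-onto e with covered (inj₂ e)
    ... | inj₂ x , refl = x , refl

-- From equal colours to equal homomorphism numbers

HomW-iso : ∀ B B′ K (ι : Fin (nV B′) → Fin (nV B)) (κ : Fin (nE B′) → Fin (nE B)) →
           (∀ {x y} → ι x ≡ ι y → x ≡ y) → (∀ {x y} → κ x ≡ κ y → x ≡ y) →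
           (∀ v → ∃ λ x → ι x ≡ v) → (∀ e → ∃ λ x → κ x ≡ e) → IsHom B′ B ι κ →
           HomW B K (λ _ _ → 1ℤ) ≡ HomW B′ K (λ _ _ → 1ℤ)
HomW-iso B B′ K ι κ ι-inj κ-inj ι-onto κ-onto hom = begin
  HomW B K (λ _ _ → 1ℤ)
    ≡⟨ sumF-cong (nV B) (λ h → trans (sumF-cong (nE B) (λ h′ → transport h h′)) (reindexE (h ∘ ι))) ⟩
  sumF (nV B) (λ h → F (h ∘ ι))
    ≡⟨ sumF-reindex ι (proj₁ ∘ ι-onto) (proj₂ ∘ ι-onto) (λ x → ι-inj (proj₂ (ι-onto (ι x)))) F
         (λ {h} {k} eq → sumF-cong (nE B′) λ h′ → isHom-cong eq (λ _ → refl)) ⟩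
  HomW B′ K (λ _ _ → 1ℤ) ∎
  where
  F₂ : (Fin (nV B′) → Fin (nV K)) → (Fin (nE B′) → Fin (nE K)) → ℤ
  F₂ h h′ = ⟦ isHom? B′ K h h′ ⟧ * prod {nV B′} (λ _ → 1ℤ)
  F : (Fin (nV B′) → Fin (nV K)) → ℤ
  F h = sumF (nE B′) (F₂ h)
  isHom-cong : ∀ {h k h′ k′} → (∀ x → h x ≡ k x) → (∀ e → h′ e ≡ k′ e) → F₂ h h′ ≡ F₂ k k′
  isHom-cong {h} {k} {h′} {k′} eq eq′ = cong (_* prod {nV B′} (λ _ → 1ℤ)) (⟦⟧-cong (isHom? B′ K h h′) (isHom? B′ K k k′)
    (λ hyp e → trans (sym (image-cong (inc B′ e) eq)) (trans (hyp e) (cong (inc K) (eq′ e))))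
    (λ hyp e → trans (image-cong (inc B′ e) eq) (trans (hyp e) (cong (inc K) (sym (eq′ e))))))
  reindexE : ∀ h → sumF (nE B) (λ h′ → F₂ h (h′ ∘ κ)) ≡ F h
  reindexE h = sumF-reindex κ (proj₁ ∘ κ-onto) (proj₂ ∘ κ-onto) (λ x → κ-inj (proj₂ (κ-onto (κ x)))) (F₂ h) (isHom-cong (λ _ → refl))
  transport : ∀ h h′ → ⟦ isHom? B K h h′ ⟧ * prod {nV B} (λ _ → 1ℤ) ≡ F₂ (h ∘ ι) (h′ ∘ κ)
  transport h h′ = cong₂ _*_
    (⟦⟧-cong (isHom? B K h h′) (isHom? B′ K (h ∘ ι) (h′ ∘ κ))
      (λ hyp e → trans (sym (image-∘ h ι (inc B′ e))) (trans (cong (image h) (hom e)) (hyp (κ e))))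
      (λ hyp e → let e′ , eq = κ-onto e in subst (λ e → image h (inc B e) ≡ inc K (h′ e)) eq
        (trans (cong (image h) (sym (hom e′))) (trans (image-∘ h ι (inc B′ e′)) (hyp e′)))))
    (trans (prod-ones {nV B}) (sym (prod-ones {nV B′})))

-- The empty hypergraph is connected in the sense of the definition but offers no vertex to explore
-- from. Edges being nonempty, it has no edges, and exactly one homomorphism to any hypergraph.
hom-empty : ∀ B G H → ¬ Fin (nV B) → Hom B G ≡ Hom B H
hom-empty record { nV = zero ; nE = zero }                          G H none = refl
hom-empty record { nV = zero ; nE = suc _ ; inc-nonempty = nonempty } G H none = ⊥-elim (none (proj₁ (nonempty zero)))
hom-empty record { nV = suc _ }                                     G H none = ⊥-elim (none zero)

not-distinguished⇒hom : ∀ G H → NotDistinguished G H → ∀ B → Connected B → BergeAcyclic B → Hom B G ≡ Hom B H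
not-distinguished⇒hom G H nd B conn acyc with any? {n = nV B} (λ _ → yes tt)
... | no none = hom-empty B G H (λ v → none (v , tt))
... | yes (v , _) = +-injective (begin
  + Hom B G                 ≡⟨ Hom-HomW B G ⟩
  HomW B G (λ _ _ → 1ℤ)     ≡⟨ iso G ⟩
  -- Constant weights respect even the trivial colouring, so the induction can start at level 0.
  HomW part G (λ _ _ → 1ℤ)  ≡⟨ HomW-respects G H nd built 0 _ _ (λ _ _ → refl) ⟩
  HomW part H (λ _ _ → 1ℤ)  ≡⟨ iso H ⟨
  HomW B H (λ _ _ → 1ℤ)     ≡⟨ Hom-HomW B H ⟨
  + Hom B H                 ∎)
  where
  explored = explore acyc (nE B) (begin-at acyc v) (ℕ.m≤m+n (nE B) 0)
  open Exploration (proj₁ explored)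
  iso : ∀ K → HomW B K (λ _ _ → 1ℤ) ≡ HomW part K (λ _ _ → 1ℤ)
  iso K = HomW-iso B part K ι κ ι-inj κ-inj (ι-onto acyc conn (proj₁ explored) (proj₂ explored))
    (κ-onto acyc conn (proj₁ explored) (proj₂ explored)) hom

-- The algebra of hypertree counts

total-replace : ∀ {n} (F F′ : Fin n → ℕ) x → (∀ y → y ≢ x → F y ≡ F′ y) → ∑ℕ.sum F ℕ.+ F′ x ≡ ∑ℕ.sum F′ ℕ.+ F x
total-replace {suc n} F F′ x off = begin
  ∑ℕ.sum F ℕ.+ F′ x              ≡⟨ cong (ℕ._+ F′ x) (∑ℕ.sum-remove {i = x} F) ⟩
  F x ℕ.+ R F ℕ.+ F′ x           ≡⟨ ℕ.+-comm (F x ℕ.+ R F) (F′ x) ⟩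
  F′ x ℕ.+ (F x ℕ.+ R F)         ≡⟨ cong (F′ x ℕ.+_) (ℕ.+-comm (F x) (R F)) ⟩
  F′ x ℕ.+ (R F ℕ.+ F x)         ≡⟨ ℕ.+-assoc (F′ x) (R F) (F x) ⟨
  F′ x ℕ.+ R F ℕ.+ F x           ≡⟨ cong (λ r → F′ x ℕ.+ r ℕ.+ F x) (∑ℕ.sum-cong-≗ (λ y → off _ (punchInᵢ≢i x y))) ⟩
  F′ x ℕ.+ R F′ ℕ.+ F x          ≡⟨ cong (ℕ._+ F x) (∑ℕ.sum-remove {i = x} F′) ⟨
  ∑ℕ.sum F′ ℕ.+ F x ∎
  where
  R : (Fin (suc n) → ℕ) → ℕ
  R F = ∑ℕ.sum (VF.removeAt F x)

total-⧺ : ∀ {A : Set} {k n} (s : A → ℕ) (f : Fin k → A) (g : Fin n → A) → ∑ℕ.sum (s ∘ (f ⧺ g)) ≡ ∑ℕ.sum (s ∘ f) ℕ.+ ∑ℕ.sum (s ∘ g)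
total-⧺ {k = zero}  s f g = refl
total-⧺ {k = suc k} s f g = trans (cong (s (f zero) ℕ.+_) (total-⧺ s (f ∘ suc) g)) (sym (ℕ.+-assoc (s (f zero)) _ _))

term≤total : ∀ {n} (F : Fin n → ℕ) x → F x ℕ.≤ ∑ℕ.sum F
term≤total F zero    = ℕ.m≤m+n _ _
term≤total F (suc x) = ℕ.≤-trans (term≤total (F ∘ suc) x) (ℕ.m≤n+m _ (F zero))

⧺-map : ∀ {A B : Set} (h : A → B) {k n} (f : Fin k → A) (g : Fin n → A) i → h ((f ⧺ g) i) ≡ ((h ∘ f) ⧺ (h ∘ g)) i
⧺-map h {zero}  f g i       = refl
⧺-map h {suc k} f g zero    = refl
⧺-map h {suc k} f g (suc i) = ⧺-map h (f ∘ suc) g i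

prod-nonzero : ∀ {n} (f : Fin n → ℤ) → (∀ x → f x ≢ 0ℤ) → prod f ≢ 0ℤ
prod-nonzero {zero}  f f≢0 e with () ← trans (sym (prod-0 f)) e
prod-nonzero {suc n} f f≢0 e with i*j≡0⇒i≡0∨j≡0 (f zero) (trans (sym (prod-suc f)) e)
... | inj₁ e₀ = f≢0 zero e₀
... | inj₂ e₁ = prod-nonzero (f ∘ suc) (f≢0 ∘ suc) e₁

prod-zero : ∀ {n} (f : Fin n → ℤ) x → f x ≡ 0ℤ → prod f ≡ 0ℤ
prod-zero f zero    e = trans (prod-suc f) (trans (cong (_* prod (f ∘ suc)) e) (*-zeroˡ (prod (f ∘ suc))))
prod-zero f (suc x) e = trans (prod-suc f) (trans (cong (f zero *_) (prod-zero (f ∘ suc) x e)) (*-zeroʳ (f zero)))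

⟦⟧-all : ∀ {n} {D : Fin n → Set} (D? : ∀ x → Dec (D x)) → ⟦ all? D? ⟧ ≡ prod (λ x → ⟦ D? x ⟧)
⟦⟧-all {zero}  D? = trans (⟦⟧-true (all? D?) (λ ())) (sym (prod-0 _))
⟦⟧-all {suc n} D? = trans
  (⟦⟧-× (all? D?) (D? zero) (all? (D? ∘ suc)) (λ d → d zero , d ∘ suc) (λ { d ds zero → d ; d ds (suc x) → ds x }))
  (trans (cong (⟦ D? zero ⟧ *_) (⟦⟧-all (D? ∘ suc))) (sym (prod-suc _)))

nonneg-* : ∀ {a b} → 0ℤ ≤ a → 0ℤ ≤ b → 0ℤ ≤ a * b
nonneg-* (+≤+ {n = m} _) (+≤+ {n = n} _) = subst (0ℤ ≤_) (pos-* m n) (+≤+ ℕ.z≤n)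

Φ-nonneg : ∀ K e p {k} (fs : Fin k → Fin (nV K) → ℤ) → (∀ j u → 0ℤ ≤ fs j u) → 0ℤ ≤ Φ K e p fs
Φ-nonneg K e p {zero}  fs fs≥0 = ⟦⟧-nonneg (p ≟ˢ inc K e)
Φ-nonneg K e p {suc k} fs fs≥0 = sum-nonneg _ λ u → nonneg-* (fs≥0 zero u) (Φ-nonneg K e (p ∪ ⁅ u ⁆) (fs ∘ suc) (fs≥0 ∘ suc))

Φ-pos : ∀ K e p {k} (fs : Fin k → Fin (nV K) → ℤ) (s : Fin k → Fin (nV K)) → (∀ j u → 0ℤ ≤ fs j u) →
        (∀ j → fs j (s j) ≡ 1ℤ) → hit p s ≡ inc K e → 0ℤ < Φ K e p fs
Φ-pos K e p {zero}  fs s fs≥0 fs≡1 h = subst (0ℤ <_) (sym (⟦⟧-true (p ≟ˢ inc K e) h)) (+<+ (ℕ.s≤s ℕ.z≤n))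
Φ-pos K e p {suc k} fs s fs≥0 fs≡1 h = sum-pos _
  (λ u → nonneg-* (fs≥0 zero u) (Φ-nonneg K e (p ∪ ⁅ u ⁆) (fs ∘ suc) (fs≥0 ∘ suc))) (s zero)
  (subst (0ℤ <_) (sym (trans (cong (_* rest) (fs≡1 zero)) (*-identityˡ rest)))
    (Φ-pos K e (p ∪ ⁅ s zero ⁆) (fs ∘ suc) (s ∘ suc) (fs≥0 ∘ suc) (fs≡1 ∘ suc) h))
  where rest = Φ K e (p ∪ ⁅ s zero ⁆) (fs ∘ suc)

nonzero-summand : ∀ {n} (f : Fin n → ℤ) → sum f ≢ 0ℤ → ∃ λ x → f x ≢ 0ℤ
nonzero-summand f s≢0 with any? (λ x → ¬? (f x ≟ 0ℤ))
... | yes found = found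
... | no  none  = ⊥-elim (s≢0 (sum-zero f λ x → decidable-stable (f x ≟ 0ℤ) λ fx≢0 → none (x , fx≢0)))

⟦⟧-nonzero : ∀ {P : Set} (d : Dec P) {c} → ⟦ d ⟧ * c ≢ 0ℤ → P × c ≢ 0ℤ
⟦⟧-nonzero (yes p) ne = p , λ { refl → ne refl }
⟦⟧-nonzero (no _) {c} ne = ⊥-elim (ne (*-zeroˡ c))

module Algebra (X : Bool → Hypergraph) where

  -- The disjoint union of the two vertex sets: vertices of one hypergraph and vertices of different
  -- ones are compared by the same relation.
  Z : Set
  Z = Σ Bool λ b → Fin (nV (X b))

  slice : ∀ {k} b → (Fin k → Z → ℤ) → Fin k → Fin (nV (X b)) → ℤ
  slice b fs j u = fs j (b , u)

  Ψ : ∀ {k} → (Fin k → Z → ℤ) → Z → ℤ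
  Ψ fs (b , v) = ψ (X b) (slice b fs) v

  -- A function satisfies Alg when a nonzero multiple of it is a ℤ-linear combination of
  -- z ↦ "number of homomorphisms from a rooted hypertree that map the root to z".
  data Alg (f : Z → ℤ) : Set where
    one : (∀ z → f z ≡ 1ℤ) → Alg f
    ext : ∀ {k} (fs : Fin k → Σ (Z → ℤ) Alg) {g} → Alg g → (∀ z → f z ≡ Ψ (proj₁ ∘ fs) z * g z) → Alg f
    lin : ∀ d a b → d ≢ 0ℤ → ∀ {g h} → Alg g → Alg h → (∀ z → d * f z ≡ a * g z + b * h z) → Alg f

  alg-cong : ∀ {f g} → (∀ z → f z ≡ g z) → Alg f → Alg g
  alg-cong eq (one e)              = one λ z → trans (sym (eq z)) (e z)
  alg-cong eq (ext fs dg e)        = ext fs dg λ z → trans (sym (eq z)) (e z)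
  alg-cong eq (lin d a b d≢0 g h e) = lin d a b d≢0 g h λ z → trans (cong (d *_) (sym (eq z))) (e z)

  alg-minus-const : ∀ {f} c → Alg f → Alg (λ z → f z - c)
  alg-minus-const {f} c df = lin 1ℤ 1ℤ (ℤ.- c) (λ ()) df (one (λ _ → refl)) (λ z → lemma (f z) c)
    where
    lemma : ∀ f c → 1ℤ * (f - c) ≡ 1ℤ * f + (ℤ.- c) * 1ℤ
    lemma = solve-∀

  -- Multiplication glues hypertrees at their roots. Recursion on the first factor suffices because
  -- the cofactor stored in `ext` takes up the second.
  alg-* : ∀ {f g} → Alg f → Alg g → Alg (λ z → f z * g z)
  alg-* {f} {g} (one e) dg = alg-cong (λ z → sym (trans (cong (_* g z) (e z)) (*-identityˡ (g z)))) dg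
  alg-* {f} {g} (ext fs {h} dh e) dg = ext fs (alg-* dh dg)
    (λ z → trans (cong (_* g z) (e z)) (*-assoc (Ψ (proj₁ ∘ fs) z) (h z) (g z)))
  alg-* {f} {g} (lin d a b d≢0 {p} {q} dp dq e) dg = lin d a b d≢0 (alg-* dp dg) (alg-* dq dg)
    (λ z → trans (sym (*-assoc d (f z) (g z))) (trans (cong (_* g z) (e z)) (lemma a (p z) b (q z) (g z))))
    where
    lemma : ∀ a p b q g → (a * p + b * q) * g ≡ a * (p * g) + b * (q * g)
    lemma = solve-∀

  alg-prod : ∀ {n} (f : Fin n → Z → ℤ) → (∀ j → Alg (f j)) → Alg (λ z → prod (λ j → f j z))
  alg-prod {zero}  f df = one λ z → prod-0 _
  alg-prod {suc n} f df = alg-cong (λ z → sym (prod-suc _)) (alg-* (df zero) (alg-prod (f ∘ suc) (df ∘ suc)))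

  alg-Ψ : ∀ {k} (fs : Fin k → Z → ℤ) → (∀ j → Alg (fs j)) → Alg (Ψ fs)
  alg-Ψ fs dfs = ext (λ j → fs j , dfs j) (one λ _ → refl) (λ z → sym (*-identityʳ _))

  -- Lagrange interpolation.
  alg-fibre : ∀ {g} → Alg g → ∀ z₀ → Alg (λ z → ⟦ g z ≟ g z₀ ⟧)
  -- The value of the interpolation polynomial at `g z₀`, its usual denominator, becomes the
  -- multiplier; the coefficient 0 fills the second slot of `lin`.
  alg-fibre {g} dg z₀ = lin (h z₀) 1ℤ 0ℤ h₀≢0 dh (one λ _ → refl) value
    where
    -- One factor per vertex rather than per value: values taken repeatedly only raise
    -- multiplicities of roots, and the value `g z₀` is replaced by the factor 1.
    factor : ∀ c → Dec (c ≡ g z₀) → ℤ → ℤ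
    factor c (yes _) t = 1ℤ
    factor c (no _)  t = t - c
    H : ∀ b → ℤ → ℤ
    H b t = prod (λ u → factor (g (b , u)) (g (b , u) ≟ g z₀) t)
    h : Z → ℤ
    h z = H false (g z) * H true (g z)
    dfactor : ∀ c d → Alg (λ z → factor c d (g z))
    dfactor c (yes _) = one λ _ → refl
    dfactor c (no _)  = alg-minus-const c dg
    dh : Alg h
    dh = alg-* (alg-prod _ λ u → dfactor (g (false , u)) (g (false , u) ≟ g z₀))
               (alg-prod _ λ u → dfactor (g (true , u)) (g (true , u) ≟ g z₀))
    factor≢0 : ∀ c d → factor c d (g z₀) ≢ 0ℤ
    factor≢0 c (yes _) ()
    factor≢0 c (no c≢) e = c≢ (sym (i-j≡0⇒i≡j (g z₀) c e))
    h₀≢0 : h z₀ ≢ 0ℤ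
    h₀≢0 e with i*j≡0⇒i≡0∨j≡0 (H false (g z₀)) e
    ... | inj₁ e₁ = prod-nonzero _ (λ u → factor≢0 (g (false , u)) (g (false , u) ≟ g z₀)) e₁
    ... | inj₂ e₂ = prod-nonzero _ (λ u → factor≢0 (g (true , u)) (g (true , u) ≟ g z₀)) e₂
    factor≡0 : ∀ t d → t ≢ g z₀ → factor t d t ≡ 0ℤ
    factor≡0 t (yes e) t≢ = ⊥-elim (t≢ e)
    factor≡0 t (no _)  _  = i≡j⇒i-j≡0 {t} {t} refl
    h≡0 : ∀ z → g z ≢ g z₀ → h z ≡ 0ℤ
    h≡0 z@(false , u) ne = trans (cong (_* H true (g z)) (prod-zero _ u (factor≡0 (g z) (g z ≟ g z₀) ne))) (*-zeroˡ (H true (g z)))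
    h≡0 z@(true , u)  ne = trans (cong (H false (g z) *_) (prod-zero _ u (factor≡0 (g z) (g z ≟ g z₀) ne))) (*-zeroʳ (H false (g z)))
    lemma : ∀ h → 1ℤ * h + 0ℤ * 1ℤ ≡ h
    lemma = solve-∀
    value : ∀ z → h z₀ * ⟦ g z ≟ g z₀ ⟧ ≡ 1ℤ * h z + 0ℤ * 1ℤ
    value z = trans (case (g z ≟ g z₀)) (sym (lemma (h z)))
      where
      case : (d : Dec (g z ≡ g z₀)) → h z₀ * ⟦ d ⟧ ≡ h z
      case (yes e) = trans (*-identityʳ (h z₀)) (cong (λ t → H false t * H true t) (sym e))
      case (no ne) = trans (*-zeroʳ (h z₀)) (sym (h≡0 z ne))

  weight : ∀ {n} b → (Fin n → Σ (Z → ℤ) Alg) → Fin n → Fin (nV (X b)) → ℤ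
  weight b ws x u = proj₁ (ws x) (b , u)

  -- Counts the `ext` and `lin` nodes of a derivation. Height 0 leaves only `one`, so a family of
  -- weights of total height 0 is constantly 1.
  height : ∀ {f} → Alg f → ℕ
  height (one _)               = 0
  height (ext fs dg _)         = suc (∑ℕ.sum (λ j → height (proj₂ (fs j))) ℕ.+ height dg)
  height (lin _ _ _ _ dg dh _) = suc (height dg ℕ.+ height dh)

  size : Σ (Z → ℤ) Alg → ℕ
  size (_ , d) = height d

  module _ (homs : ∀ B → Connected B → BergeAcyclic B → Hom B (X false) ≡ Hom B (X true)) where

    update-total : ∀ {n} (ws : Fin n → Σ (Z → ℤ) Alg) x w →
                   ∑ℕ.sum (size ∘ update x w ws) ℕ.+ size (ws x) ≡ ∑ℕ.sum (size ∘ ws) ℕ.+ size w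
    update-total ws x w = trans (total-replace (size ∘ update x w ws) (size ∘ ws) x (λ y y≢x → cong size (update-off x w ws y y≢x)))
      (cong (λ d → ∑ℕ.sum (size ∘ ws) ℕ.+ size d) (update-at x w ws))

    -- Unfolding the derivation of one weight either attaches an edge or splits the count linearly.
    weighted-homs : ∀ N B → Connected B → BergeAcyclic B → (ws : Fin (nV B) → Σ (Z → ℤ) Alg) → ∑ℕ.sum (size ∘ ws) ℕ.≤ N →
                    HomW B (X false) (weight false ws) ≡ HomW B (X true) (weight true ws)
    weighted-homs N B conn acyc ws bound with any? (λ x → 1 ℕ.≤? size (ws x))
    ... | no none = begin
      HomW B (X false) (weight false ws) ≡⟨ HomW-cong B (X false) (λ x u → trivial (ws x) (λ s → none (x , s)) (false , u)) ⟩
      HomW B (X false) (λ _ _ → 1ℤ)      ≡⟨ Hom-HomW B (X false) ⟨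
      + Hom B (X false)                  ≡⟨ cong +_ (homs B conn acyc) ⟩
      + Hom B (X true)                   ≡⟨ Hom-HomW B (X true) ⟩
      HomW B (X true) (λ _ _ → 1ℤ)       ≡⟨ HomW-cong B (X true) (λ x u → trivial (ws x) (λ s → none (x , s)) (true , u)) ⟨
      HomW B (X true) (weight true ws)   ∎
      where
      trivial : ∀ w → ¬ (1 ℕ.≤ size w) → ∀ z → proj₁ w z ≡ 1ℤ
      trivial (_ , one e)              _  z = e z
      trivial (_ , ext _ _ _)          ¬s z = ⊥-elim (¬s (ℕ.s≤s ℕ.z≤n))
      trivial (_ , lin _ _ _ _ _ _ _)  ¬s z = ⊥-elim (¬s (ℕ.s≤s ℕ.z≤n))
    weighted-homs zero    B conn acyc ws bound | yes (x , s) =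
      ⊥-elim (ℕ.<-irrefl refl (ℕ.≤-trans s (ℕ.≤-trans (term≤total (size ∘ ws) x) bound)))
    weighted-homs (suc N) B conn acyc ws bound | yes (x , s) = unfold (ws x) refl
      where
      -- Here m is what the unfolded derivation releases besides w: the heights of the new vertices'
      -- weights for `ext`, the height of the other summand for `lin`.
      smaller : ∀ w m → size (ws x) ≡ suc (m ℕ.+ size w) → m ℕ.+ ∑ℕ.sum (size ∘ update x w ws) ℕ.≤ N
      smaller w m eq = ℕ.s≤s⁻¹ (subst (ℕ._≤ suc N) (ℕ.+-cancelʳ-≡ (size w) _ _ (begin
        ∑ℕ.sum (size ∘ ws) ℕ.+ size w                                ≡⟨ update-total ws x w ⟨
        ∑ℕ.sum (size ∘ update x w ws) ℕ.+ size (ws x)                ≡⟨ cong (∑ℕ.sum (size ∘ update x w ws) ℕ.+_) eq ⟩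
        ∑ℕ.sum (size ∘ update x w ws) ℕ.+ (suc m ℕ.+ size w)         ≡⟨ ℕ.+-assoc (∑ℕ.sum (size ∘ update x w ws)) (suc m) (size w) ⟨
        ∑ℕ.sum (size ∘ update x w ws) ℕ.+ suc m ℕ.+ size w           ≡⟨ cong (ℕ._+ size w) (ℕ.+-comm (∑ℕ.sum (size ∘ update x w ws)) (suc m)) ⟩
        suc m ℕ.+ ∑ℕ.sum (size ∘ update x w ws) ℕ.+ size w           ∎)) bound)
      off : ∀ w b y → y ≢ x → ∀ u → weight b (update x w ws) y u ≡ weight b ws y u
      off w b y y≢x u = cong (λ w → proj₁ w (b , u)) (update-off x w ws y y≢x)
      at : ∀ w b u → weight b (update x w ws) x u ≡ proj₁ w (b , u)
      at w b u = cong (λ w → proj₁ w (b , u)) (update-at x w ws)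
      unfold : ∀ w → ws x ≡ w → HomW B (X false) (weight false ws) ≡ HomW B (X true) (weight true ws)
      unfold (_ , one _) eq with () ← subst (λ w → 1 ℕ.≤ size w) eq s
      unfold (f , ext {k} fs {g} dg e) eq = begin
        HomW B (X false) (weight false ws)                    ≡⟨ attached false ⟨
        HomW (attach B x k) (X false) (weight false ws′)      ≡⟨ weighted-homs N (attach B x k) (attach-connected B x k conn) (attach-acyclic B x k acyc) ws′
                                                                   (subst (ℕ._≤ N) (sym (total-⧺ size fs (update x (g , dg) ws))) (smaller (g , dg) (∑ℕ.sum (size ∘ fs)) (cong size eq))) ⟩
        HomW (attach B x k) (X true) (weight true ws′)        ≡⟨ attached true ⟩
        HomW B (X true) (weight true ws)                      ∎
        where
        ws′ = fs ⧺ update x (g , dg) ws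
        attached : ∀ b → HomW (attach B x k) (X b) (weight b ws′) ≡ HomW B (X b) (weight b ws)
        attached b = trans
          (HomW-cong (attach B x k) (X b) (λ i u → cong (λ f → f u) (⧺-map (λ w u → proj₁ w (b , u)) fs (update x (g , dg) ws) i)))
          (HomW-attach B (X b) x (slice b (proj₁ ∘ fs)) (weight b ws) (weight b (update x (g , dg) ws))
            (λ y y≢x u → sym (off (g , dg) b y y≢x u))
            (λ u → trans (cong (λ w → proj₁ w (b , u)) eq) (trans (e (b , u)) (cong (Ψ (proj₁ ∘ fs) (b , u) *_) (sym (at (g , dg) b u))))))
      unfold (f , lin d p q d≢0 {g} {h} dg dh e) eq = *-cancelˡ-≡ d _ _ {{ℤ.≢-nonZero d≢0}} (begin
        d * HomW B (X false) (weight false ws)    ≡⟨ linear false ⟩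
        p * HomW B (X false) (weight false (update x (g , dg) ws)) + q * HomW B (X false) (weight false (update x (h , dh) ws))
          ≡⟨ cong₂ (λ s t → p * s + q * t)
               (weighted-homs N B conn acyc (update x (g , dg) ws) (ℕ.≤-trans (ℕ.m≤n+m _ (size (h , dh)))
                 (smaller (g , dg) (size (h , dh)) (trans (cong size eq) (cong suc (ℕ.+-comm (size (g , dg)) (size (h , dh))))))))
               (weighted-homs N B conn acyc (update x (h , dh) ws) (ℕ.≤-trans (ℕ.m≤n+m _ (size (g , dg))) (smaller (h , dh) (size (g , dg)) (cong size eq)))) ⟩
        p * HomW B (X true) (weight true (update x (g , dg) ws)) + q * HomW B (X true) (weight true (update x (h , dh) ws))
          ≡⟨ linear true ⟨
        d * HomW B (X true) (weight true ws) ∎)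
        where
        linear : ∀ b → d * HomW B (X b) (weight b ws) ≡
                 p * HomW B (X b) (weight b (update x (g , dg) ws)) + q * HomW B (X b) (weight b (update x (h , dh) ws))
        linear b = HomW-linear B (X b) x d p q (weight b ws) (weight b (update x (g , dg) ws)) (weight b (update x (h , dh) ws))
          (λ y y≢x u → off (g , dg) b y y≢x u , off (h , dh) b y y≢x u)
          (λ u → trans (cong (λ w → d * proj₁ w (b , u)) eq) (trans (e (b , u))
            (cong₂ (λ s t → p * s + q * t) (sym (at (g , dg) b u)) (sym (at (h , dh) b u)))))

    alg-sum : ∀ {f} → Alg f → sum (λ u → f (false , u)) ≡ sum (λ u → f (true , u))
    alg-sum {f} df = trans (sym (HomW-point (X false) (weight false ws))) (trans
      (weighted-homs _ point point-connected point-acyclic ws ℕ.≤-refl) (HomW-point (X true) (weight true ws)))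
      where
      ws : Fin 1 → Σ (Z → ℤ) Alg
      ws _ = f , df

+-cancelʳ-≤ : ∀ k i j → i + k ≤ j + k → i ≤ j
+-cancelʳ-≤ k i j i+k≤j+k = subst₂ _≤_ (lemma i k) (lemma j k) (+-monoˡ-≤ (ℤ.- k) i+k≤j+k)
  where
  lemma : ∀ i k → i + k + ℤ.- k ≡ i
  lemma = solve-∀

-- Homomorphism counts determine colours

⟦⟧-⊎ : ∀ {P Q R S : Set} (p : Dec P) (q : Dec Q) (r : Dec R) (s : Dec S) → (P → Q ⊎ R × S) → ⟦ p ⟧ ≤ ⟦ q ⟧ + ⟦ r ⟧ * ⟦ s ⟧
⟦⟧-⊎ (no _)  q       r       s       f = +-mono-≤ (⟦⟧-nonneg q) (nonneg-* (⟦⟧-nonneg r) (⟦⟧-nonneg s))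
⟦⟧-⊎ (yes _) (yes _) r       s       f = +-monoʳ-≤ 1ℤ (nonneg-* (⟦⟧-nonneg r) (⟦⟧-nonneg s))
⟦⟧-⊎ (yes _) (no _)  (yes _) (yes _) f = ≤-refl
⟦⟧-⊎ (yes p) (no ¬q) (no ¬r) s       f = ⊥-elim (Sum.[ ¬q , ¬r ∘ proj₁ ] (f p))
⟦⟧-⊎ (yes p) (no ¬q) (yes _) (no ¬s) f = ⊥-elim (Sum.[ ¬q , ¬s ∘ proj₂ ] (f p))

bool? : ∀ {P : Bool → Set} → (∀ b → Dec (P b)) → Dec (∀ b → P b)
bool? P? = map′ (λ { (f , t) false → f ; (f , t) true → t }) (λ p → p false , p true) (P? false ×-dec P? true)

module Refinement (X : Bool → Hypergraph) where

  open Algebra X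

  alg-×-dec : ∀ {D D′ : Z → Set} {D? : ∀ z → Dec (D z)} {D′? : ∀ z → Dec (D′ z)} →
              Alg (λ z → ⟦ D? z ⟧) → Alg (λ z → ⟦ D′? z ⟧) → Alg (λ z → ⟦ D? z ×-dec D′? z ⟧)
  alg-×-dec {D? = D?} {D′?} d d′ = alg-cong (λ z → sym (⟦⟧-× (D? z ×-dec D′? z) (D? z) (D′? z) id _,_)) (alg-* d d′)

  alg-all? : ∀ {n} {D : Fin n → Z → Set} {D? : ∀ j z → Dec (D j z)} →
             (∀ j → Alg (λ z → ⟦ D? j z ⟧)) → Alg (λ z → ⟦ all? (λ j → D? j z) ⟧)
  alg-all? {D? = D?} d = alg-cong (λ z → sym (⟦⟧-all (λ j → D? j z))) (alg-prod _ d)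

  alg-bool? : ∀ {D : Bool → Z → Set} {D? : ∀ b z → Dec (D b z)} →
              (∀ b → Alg (λ z → ⟦ D? b z ⟧)) → Alg (λ z → ⟦ bool? (λ b → D? b z) ⟧)
  alg-bool? {D? = D?} d = alg-cong
    (λ z → sym (⟦⟧-× (bool? (λ b → D? b z)) (D? false z) (D? true z) (λ p → p false , p true) (λ { f t false → f ; f t true → t })))
    (alg-* (d false) (d true))

  -- Unlike `SameColour`, this is a decidable equivalence on both vertex sets at once. Class
  -- indicators in the algebra are what lets the hypothesis on homomorphism numbers speak about
  -- class sizes.
  record Colouring : Set₁ where
    field
      _~_       : Z → Z → Set
      _~?_      : ∀ z z′ → Dec (z ~ z′)
      ~refl     : ∀ {z} → z ~ z
      ~sym      : ∀ {z z′} → z ~ z′ → z′ ~ z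
      ~trans    : ∀ {z z′ z″} → z ~ z′ → z′ ~ z″ → z ~ z″
      definable : ∀ z₀ → Alg (λ z → ⟦ z ~? z₀ ⟧)

  trivial : Colouring
  trivial = record { _~_ = λ _ _ → ⊤ ; _~?_ = λ _ _ → yes tt ; ~refl = tt ; ~sym = id ; ~trans = λ _ → id
                   ; definable = λ _ → one λ _ → refl }

  EE : Set
  EE = Σ Bool λ b → Fin (nE (X b))

  module Step (L : Colouring) where
    open Colouring L

    indicators : ∀ b (e : Fin (nE (X b))) u → Fin (Others.size (inc (X b) e) u) → Z → ℤ
    indicators b e u j z = ⟦ z ~? (b , Others.other (inc (X b) e) u j) ⟧

    test : ∀ b → Fin (nE (X b)) → Fin (nV (X b)) → Z → ℤ
    test b e u = Ψ (indicators b e u)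

    -- Finitely many tests suffice, one for each edge and each vertex as root. A new class is the
    -- intersection of an old one with fibres of the tests, hence definable by `alg-fibre`.
    next : Colouring
    next = record
      { _~_ = λ z z′ → z ~ z′ × (∀ b e u → test b e u z ≡ test b e u z′)
      ; _~?_ = λ z z′ → (z ~? z′) ×-dec bool? (λ b → all? λ e → all? λ u → test b e u z ≟ test b e u z′)
      ; ~refl = ~refl , λ _ _ _ → refl
      ; ~sym = λ (s , t) → ~sym s , λ b e u → sym (t b e u)
      ; ~trans = λ (s , t) (s′ , t′) → ~trans s s′ , λ b e u → trans (t b e u) (t′ b e u)
      ; definable = λ z₀ → alg-×-dec {D? = λ z → z ~? z₀} {D′? = λ z → bool? (λ b → all? λ e → all? λ u → test b e u z ≟ test b e u z₀)}
          (definable z₀) (alg-bool? {D? = λ b z → all? λ e → all? λ u → test b e u z ≟ test b e u z₀}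
            λ b → alg-all? {D? = λ e z → all? λ u → test b e u z ≟ test b e u z₀}
            λ e → alg-all? {D? = λ u z → test b e u z ≟ test b e u z₀}
            λ u → alg-fibre (alg-Ψ (indicators b e u) (λ j → definable _)) z₀) }

    measure : {D : Z → Set} → (∀ z → Dec (D z)) → ∀ b → Subset (nV (X b)) → ℤ
    measure D? b p = sum (λ u → ⟦ (u ∈? p) ×-dec D? (b , u) ⟧)

    card : EE → ℕ
    card (b , e) = count (λ u → u ∈? inc (X b) e)

    infix 4 _≈_
    -- The colour type of an edge, given by class counts so that it is decidable; `≈-matching`
    -- recovers the bijection of vertices. The cardinality is recorded for the induction on edge
    -- size.
    _≈_ : EE → EE → Set
    (b , e) ≈ (b′ , e′) = card (b , e) ≡ card (b′ , e′) ×
      (∀ a u → measure (_~? (a , u)) b (inc (X b) e) ≡ measure (_~? (a , u)) b′ (inc (X b′) e′))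

    _≈?_ : ∀ d d′ → Dec (d ≈ d′)
    (b , e) ≈? (b′ , e′) = (card (b , e) ℕ.≟ card (b′ , e′)) ×-dec
      bool? (λ a → all? λ u → measure (_~? (a , u)) b (inc (X b) e) ≟ measure (_~? (a , u)) b′ (inc (X b′) e′))

    ≈refl : ∀ {d} → d ≈ d
    ≈refl = refl , λ _ _ → refl

    ≈sym : ∀ {d d′} → d ≈ d′ → d′ ≈ d
    ≈sym (c , m) = sym c , λ a u → sym (m a u)

    ≈trans : ∀ {d d′ d″} → d ≈ d′ → d′ ≈ d″ → d ≈ d″
    ≈trans (c , m) (c′ , m′) = trans c c′ , λ a u → trans (m a u) (m′ a u)

    ≈-matching : ∀ {b e b′ e′} → (b , e) ≈ (b′ , e′) →
                 Matching (_∈ inc (X b) e) (_∈ inc (X b′) e′) (λ u u′ → (b , u) ~ (b′ , u′))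
    ≈-matching {b} {e} {b′} {e′} (_ , m) = counts⇒matching _~?_ ~sym ~trans
      (λ u → u ∈? inc (X b) e) (λ u → u ∈? inc (X b′) e′) (b ,_) (b′ ,_) (λ (a , u) → m a u) ~refl

    ~zigzag : ∀ {b b′} → Zigzag {nV (X b)} {nV (X b′)} (λ u u′ → (b , u) ~ (b′ , u′))
    ~zigzag r s t = ~trans r (~trans (~sym s) t)

    -- Class indicators agree on vertices paired by `≈-matching`. So the contribution of an edge to
    -- a test depends only on its type and on the class of the root.
    Φ-≈ : ∀ {b e b′ e′} → (b , e) ≈ (b′ , e′) → ∀ {v v′} → v ∈ inc (X b) e → v′ ∈ inc (X b′) e′ → (b , v) ~ (b′ , v′) →
          ∀ a (d : Fin (nE (X a))) u →
          Φ (X b) e ⁅ v ⁆ (slice b (indicators a d u)) ≡ Φ (X b′) e′ ⁅ v′ ⁆ (slice b′ (indicators a d u))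
    Φ-≈ {b} {e} {b′} {e′} e≈e′ v∈ v′∈ v~v′ a d u = Φ-rooted (X b) (X b′) ~zigzag (≈-matching e≈e′) v∈ v′∈ v~v′
      (slice b (indicators a d u)) (slice b′ (indicators a d u))
      (λ j {x} {y} r → let z = a , Others.other (inc (X a) d) u j in ⟦⟧-cong ((b , x) ~? z) ((b′ , y) ~? z) (~trans (~sym r)) (~trans r))

    -- Unions of classes: domination is applied to a class, to its complement and to everything.
    Invariant : (Z → Set) → Set
    Invariant D = ∀ {z z′} → z ~ z′ → D z → D z′

    measure-singleton : ∀ {D : Z → Set} (D? : ∀ z → Dec (D z)) b v → measure D? b ⁅ v ⁆ ≡ ⟦ D? (b , v) ⟧
    measure-singleton D? b v = trans
      (sum-cong λ u → ⟦⟧-× ((u ∈? ⁅ v ⁆) ×-dec D? (b , u)) (u ≟ᶠ v) (D? (b , u))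
        (λ (u∈ , d) → x∈⁅y⁆⇒x≡y v u∈ , d) (λ { refl d → x∈⁅x⁆ v , d }))
      (sum-delta v _)

    measure-insert : ∀ {D : Z → Set} (D? : ∀ z → Dec (D z)) b p v → measure D? b (p ∪ ⁅ v ⁆) ≤ measure D? b p + ⟦ D? (b , v) ⟧
    measure-insert D? b p v = ≤-trans (sum-mono _ _ bound) (≤-reflexive (trans (sum-+ _ _) (cong (_+_ (measure D? b p)) (sum-delta v _))))
      where
      bound : ∀ u → ⟦ (u ∈? (p ∪ ⁅ v ⁆)) ×-dec D? (b , u) ⟧ ≤ ⟦ (u ∈? p) ×-dec D? (b , u) ⟧ + ⟦ u ≟ᶠ v ⟧ * ⟦ D? (b , u) ⟧
      bound u = ⟦⟧-⊎ ((u ∈? (p ∪ ⁅ v ⁆)) ×-dec D? (b , u)) ((u ∈? p) ×-dec D? (b , u)) (u ≟ᶠ v) (D? (b , u))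
        (λ (u∈ , d) → Sum.map (_, d) (_, d) (∈-cases p u∈))

    -- A nonvanishing term of Φ has an e covered by p and images of the colours of the s j.
    Φ-dominated : ∀ {D : Z → Set} (D? : ∀ z → Dec (D z)) → Invariant D → ∀ b e p {k} (s : Fin k → Z) →
                  Φ (X b) e p (λ j u → ⟦ (b , u) ~? s j ⟧) ≢ 0ℤ →
                  measure D? b (inc (X b) e) ≤ measure D? b p + sum (λ j → ⟦ D? (s j) ⟧)
    Φ-dominated D? inv b e p {zero} s ne with p ≟ˢ inc (X b) e
    ... | yes refl = ≤-reflexive (sym (trans (cong (_+_ (measure D? b p)) (sum-0 _)) (+-identityʳ _)))
    ... | no _     = ⊥-elim (ne refl)
    Φ-dominated D? inv b e p {suc k} s ne =
      let u , ne′ = nonzero-summand _ ne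
          u~s , ne″ = ⟦⟧-nonzero ((b , u) ~? s zero) ne′
      in ≤-trans (Φ-dominated D? inv b e (p ∪ ⁅ u ⁆) (s ∘ suc) ne″)
        (≤-trans (+-monoˡ-≤ (sum (λ j → ⟦ D? (s (suc j)) ⟧)) (measure-insert D? b p u))
        (≤-reflexive (trans (+-assoc (measure D? b p) _ _) (cong (_+_ (measure D? b p))
          (trans (cong (_+ sum (λ j → ⟦ D? (s (suc j)) ⟧)) (⟦⟧-cong (D? (b , u)) (D? (s zero)) (inv u~s) (inv (~sym u~s))))
            (sym (sum-suc _)))))))

    measure-others : ∀ {D : Z → Set} (D? : ∀ z → Dec (D z)) b e {u} → u ∈ inc (X b) e →
                     ⟦ D? (b , u) ⟧ + sum (λ j → ⟦ D? (b , Others.other (inc (X b) e) u j) ⟧) ≡ measure D? b (inc (X b) e)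
    measure-others D? b e {u} u∈ = trans (sym (sum-suc (λ j → ⟦ D? (b , s j) ⟧)))
      (sum-match (λ j v → s j ≟ᶠ v) (λ { refl refl → refl }) (λ {i} {j} x y → s-injective i j (trans x (sym y)))
        (λ j → ⟦ D? (b , s j) ⟧) _
        (λ { {j} refl → ⟦⟧-cong (D? (b , s j)) ((s j ∈? inc (X b) e) ×-dec D? (b , s j)) (s-∈ j ,_) proj₂ })
        (λ j → inj₂ (s j , refl)) onto)
      where
      open Others (inc (X b) e) u
      s : Fin (suc _) → Fin (nV (X b))
      s = u VF.∷ other
      s-∈ : ∀ j → s j ∈ inc (X b) e
      s-∈ zero    = u∈
      s-∈ (suc j) = other-∈ j
      s-injective : ∀ i j → s i ≡ s j → i ≡ j
      s-injective zero    zero    _  = refl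
      s-injective zero    (suc j) eq = ⊥-elim (other-≢ j (sym eq))
      s-injective (suc i) zero    eq = ⊥-elim (other-≢ i eq)
      s-injective (suc i) (suc j) eq = cong suc (other-injective i j eq)
      onto : ∀ v → ⟦ (v ∈? inc (X b) e) ×-dec D? (b , v) ⟧ ≡ 0ℤ ⊎ ∃ λ j → s j ≡ v
      onto v with v ∈? inc (X b) e
      ... | no v∉ = inj₁ (⟦⟧-false (no v∉ ×-dec D? (b , v)) (v∉ ∘ proj₁))
      ... | yes v∈ with v ≟ᶠ u
      ...   | yes eq = inj₂ (zero , sym eq)
      ...   | no v≢u = let j , eq = other-surjective v∈ v≢u in inj₂ (suc j , eq)

    measure-split : ∀ {D : Z → Set} (D? : ∀ z → Dec (D z)) b e → measure D? b (inc (X b) e) + measure (¬? ∘ D?) b (inc (X b) e) ≡ + card (b , e)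
    measure-split D? b e = trans (sym (sum-+ _ _)) (trans (sum-cong split-at) (count-sum (λ u → u ∈? inc (X b) e)))
      where
      split-at : ∀ u → ⟦ (u ∈? inc (X b) e) ×-dec D? (b , u) ⟧ + ⟦ (u ∈? inc (X b) e) ×-dec ¬? (D? (b , u)) ⟧ ≡ ⟦ u ∈? inc (X b) e ⟧
      split-at u with u ∈? inc (X b) e | D? (b , u)
      ... | yes _ | yes _ = refl
      ... | yes _ | no _  = refl
      ... | no _  | _     = refl

    module _ (b : Bool) (e : Fin (nE (X b))) {u : Fin (nV (X b))} (u∈e : u ∈ inc (X b) e) where

      -- The edge d is covered by v and the placed vertices, whose colours are those of the other
      -- vertices of e. As v ~ u, the resulting bound adds up to the measure of e by
      -- `measure-others`.
      dominated : ∀ {a d v} → (a , v) ~ (b , u) → Φ (X a) d ⁅ v ⁆ (slice a (indicators b e u)) ≢ 0ℤ →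
                  ∀ {D : Z → Set} (D? : ∀ z → Dec (D z)) → Invariant D → measure D? a (inc (X a) d) ≤ measure D? b (inc (X b) e)
      dominated {a} {d} {v} v~u ne D? inv = ≤-trans (Φ-dominated D? inv a d ⁅ v ⁆ (λ j → b , Others.other (inc (X b) e) u j) ne) (≤-reflexive (trans
        (cong (_+ sum (λ j → ⟦ D? (b , Others.other (inc (X b) e) u j) ⟧)) (trans (measure-singleton D? a v) (⟦⟧-cong (D? (a , v)) (D? (b , u)) (inv v~u) (inv (~sym v~u)))))
        (measure-others D? b e u∈e)))

      -- Domination for the set of all vertices gives the equality of sizes. A class and its
      -- complement then have measures that are bounded one by one and have equal sums, so both
      -- bounds are equalities.
      dominated⇒≈ : ∀ {a d v} → (a , v) ~ (b , u) → Φ (X a) d ⁅ v ⁆ (slice a (indicators b e u)) ≢ 0ℤ →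
                    ¬ (card (a , d) ℕ.< card (b , e)) → (a , d) ≈ (b , e)
      dominated⇒≈ {a} {d} {v} v~u ne ≮ = card≡ , λ c w →
        let D? = _~? (c , w)
            inv : Invariant (_~ (c , w))
            inv s t = ~trans (~sym s) t
            x≤ = dominated v~u ne {_~ (c , w)} D? inv
            y≤ = dominated v~u ne {λ z → ¬ z ~ (c , w)} (¬? ∘ D?) (λ s n t → n (inv (~sym s) t))
        in ≤-antisym x≤ (+-cancelʳ-≤ (measure (¬? ∘ D?) a (inc (X a) d)) (measure D? b (inc (X b) e)) (measure D? a (inc (X a) d))
             (≤-trans (+-monoʳ-≤ (measure D? b (inc (X b) e)) y≤)
               (≤-reflexive (trans (measure-split {_~ (c , w)} D? b e) (trans (cong +_ (sym card≡)) (sym (measure-split {_~ (c , w)} D? a d)))))))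
        where
        all-measure : ∀ a d → measure (λ _ → yes tt) a (inc (X a) d) ≡ + card (a , d)
        all-measure a d = trans (sum-cong λ u → ⟦⟧-cong ((u ∈? inc (X a) d) ×-dec yes tt) (u ∈? inc (X a) d) proj₁ (_, tt)) (count-sum (λ u → u ∈? inc (X a) d))
        card≡ : card (a , d) ≡ card (b , e)
        card≡ = ℕ.≤-antisym
          (drop‿+≤+ (subst₂ _≤_ (all-measure a d) (all-measure b e) (dominated v~u ne (λ _ → yes tt) (λ _ _ → tt))))
          (ℕ.≮⇒≥ ≮)

      leading : ℤ
      leading = Φ (X b) e ⁅ u ⁆ (slice b (indicators b e u))

      -- All terms are nonnegative, and placing the new vertices on the other vertices of e gives a
      -- positive one.
      leading≢0 : leading ≢ 0ℤ
      leading≢0 eq = <-irrefl (sym eq) (Φ-pos (X b) e ⁅ u ⁆ _ (Others.other (inc (X b) e) u)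
        (λ j w → ⟦⟧-nonneg ((b , w) ~? _)) (λ j → ⟦⟧-true (_ ~? _) ~refl) (Others.hit-others (inc (X b) e) u u∈e))

      small : Z → ℤ
      small (a , v) = sum (λ d → ⟦ card (a , d) ℕ.<? card (b , e) ⟧ * Φ (X a) d ⁅ v ⁆ (slice a (indicators b e u)))

    degree : EE → Z → ℤ
    degree e₀ (a , v) = sum (λ d → ⟦ (v ∈? inc (X a) d) ×-dec ((a , d) ≈? e₀) ⟧)

    -- Edges of the type of e at z contribute `leading` each by `Φ-≈`. Any other edge with a nonzero
    -- contribution is smaller than e by `dominated⇒≈`, and `small` collects those.
    test-expansion : ∀ b e {u} (u∈e : u ∈ inc (X b) e) z → z ~ (b , u) →
                     test b e u z ≡ small b e u∈e z + leading b e u∈e * degree (b , e) z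
    test-expansion b e {u} u∈e (a , v) v~u = trans (sum-cong summand) (trans (sum-+ _ _) (cong (_+_ (small b e u∈e (a , v))) (sum-*ˡ (leading b e u∈e) _)))
      where
      n : Fin (nE (X a)) → ℤ
      n d = Φ (X a) d ⁅ v ⁆ (slice a (indicators b e u))
      keep : ∀ {P : Set} (s : Dec P) c x → x ≡ 0ℤ ⊎ P → x ≡ ⟦ s ⟧ * x + c * 0ℤ
      keep s c x (inj₁ refl) = sym (cong₂ _+_ (*-zeroʳ ⟦ s ⟧) (*-zeroʳ c))
      keep s c x (inj₂ p)    = sym (trans (cong₂ _+_ (trans (cong (_* x) (⟦⟧-true s p)) (*-identityˡ x)) (*-zeroʳ c)) (+-identityʳ x))
      vanish : ∀ d → ¬ (v ∈ inc (X a) d × (a , d) ≈ (b , e)) → n d ≡ 0ℤ ⊎ card (a , d) ℕ.< card (b , e)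
      vanish d ¬match with n d ≟ 0ℤ | card (a , d) ℕ.<? card (b , e) | v ∈? inc (X a) d
      ... | yes eq | _      | _      = inj₁ eq
      ... | no _   | yes lt | _      = inj₂ lt
      ... | no ne  | no _   | no v∉  = ⊥-elim (ne (Φ-outside (X a) d ⁅ v ⁆ (slice a (indicators b e u)) (x∈⁅x⁆ v) v∉))
      ... | no ne  | no ≮   | yes v∈ = ⊥-elim (¬match (v∈ , dominated⇒≈ b e u∈e v~u ne ≮))
      summand : ∀ d → n d ≡ ⟦ card (a , d) ℕ.<? card (b , e) ⟧ * n d + leading b e u∈e * ⟦ (v ∈? inc (X a) d) ×-dec ((a , d) ≈? (b , e)) ⟧
      summand d = by-cases ((v ∈? inc (X a) d) ×-dec ((a , d) ≈? (b , e)))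
        where
        by-cases : (m : Dec (v ∈ inc (X a) d × (a , d) ≈ (b , e))) → n d ≡ ⟦ card (a , d) ℕ.<? card (b , e) ⟧ * n d + leading b e u∈e * ⟦ m ⟧
        by-cases (no ¬match) = keep (card (a , d) ℕ.<? card (b , e)) (leading b e u∈e) (n d) (vanish d ¬match)
        by-cases (yes (v∈ , d≈e)) = sym (begin
          ⟦ card (a , d) ℕ.<? card (b , e) ⟧ * n d + leading b e u∈e * 1ℤ
            ≡⟨ cong₂ _+_ (cong (_* n d) (⟦⟧-false (card (a , d) ℕ.<? card (b , e)) (ℕ.<-irrefl (proj₁ d≈e)))) (*-identityʳ (leading b e u∈e)) ⟩
          0ℤ * n d + leading b e u∈e  ≡⟨ trans (cong (_+ leading b e u∈e) (*-zeroˡ (n d))) (+-identityˡ _) ⟩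
          leading b e u∈e             ≡⟨ Φ-≈ d≈e v∈ u∈e v~u b e u ⟨
          n d ∎)

    degree-empty : ∀ b e z → (∀ u → u ∈ inc (X b) e → ¬ z ~ (b , u)) → degree (b , e) z ≡ 0ℤ
    degree-empty b e (a , v) none = sum-zero _ λ d → ⟦⟧-false ((v ∈? inc (X a) d) ×-dec ((a , d) ≈? (b , e)))
      λ (v∈ , d≈e) → let open Matching (≈-matching d≈e) ; u , t = totalˡ v∈ ; _ , u∈ , v~u = sound t in none u u∈ v~u

    module _ {z z′ : Z} (z~z′ : Colouring._~_ next z z′) where

      -- If e has a vertex in the class of z, the test of e rooted there has equal values at z and
      -- z′; its small parts agree by induction, and the common nonzero factor `leading` cancels. If
      -- e has no such vertex, both degrees are 0.
      degree-≡ : ∀ s b e → card (b , e) ℕ.< s → degree (b , e) z ≡ degree (b , e) z′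
      degree-≡ (suc s) b e (ℕ.s≤s bound) with any? (λ u → (u ∈? inc (X b) e) ×-dec (z ~? (b , u)))
      ... | no none = trans (degree-empty b e z λ u u∈ r → none (u , u∈ , r))
                       (sym (degree-empty b e z′ λ u u∈ r → none (u , u∈ , ~trans (proj₁ z~z′) r)))
      ... | yes (u , u∈ , z~u) = *-cancelˡ-≡ (leading b e u∈) _ _ {{ℤ.≢-nonZero (leading≢0 b e u∈)}}
          (∙-cancelˡ (small b e u∈ z) _ _ (begin
            small b e u∈ z + leading b e u∈ * degree (b , e) z    ≡⟨ test-expansion b e u∈ z z~u ⟨
            test b e u z                                          ≡⟨ proj₂ z~z′ b e u ⟩
            test b e u z′                                         ≡⟨ test-expansion b e u∈ z′ (~trans (~sym (proj₁ z~z′)) z~u) ⟩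
            small b e u∈ z′ + leading b e u∈ * degree (b , e) z′  ≡⟨ cong (_+ _) small-≡ ⟨
            small b e u∈ z + leading b e u∈ * degree (b , e) z′   ∎))
          where
          open Algebra.Properties.Group (AbelianGroup.group +-0-abelianGroup) using (∙-cancelˡ)
          P? : ∀ a v d → Dec (v ∈ inc (X a) d × card (a , d) ℕ.< card (b , e))
          P? a v d = (v ∈? inc (X a) d) ×-dec (card (a , d) ℕ.<? card (b , e))
          -- To match the smaller edges at z and z′ by type, they are counted by type: this gives
          -- the degree for types below the size of e, equal by induction, and 0 for all other
          -- types.
          restricted : ∀ a v (c : Bool) d → ℤ
          restricted a v c d = sum (λ d′ → ⟦ P? a v d′ ×-dec ((a , d′) ≈? (c , d)) ⟧)
          restricted-degree : ∀ a v c d → card (c , d) ℕ.< card (b , e) → restricted a v c d ≡ degree (c , d) (a , v)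
          restricted-degree a v c d lt = sum-cong λ d′ → ⟦⟧-cong (P? a v d′ ×-dec ((a , d′) ≈? (c , d))) ((v ∈? inc (X a) d′) ×-dec ((a , d′) ≈? (c , d)))
            (λ ((v∈ , _) , r) → v∈ , r) (λ (v∈ , r) → (v∈ , subst (ℕ._< card (b , e)) (sym (proj₁ r)) lt) , r)
          restricted-zero : ∀ a v c d → ¬ (card (c , d) ℕ.< card (b , e)) → restricted a v c d ≡ 0ℤ
          restricted-zero a v c d ≮ = sum-zero _ λ d′ → ⟦⟧-false (P? a v d′ ×-dec ((a , d′) ≈? (c , d)))
            λ ((_ , lt) , r) → ≮ (subst (ℕ._< card (b , e)) (proj₁ r) lt)
          restricted-≡ : ∀ c d → restricted (proj₁ z) (proj₂ z) c d ≡ restricted (proj₁ z′) (proj₂ z′) c d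
          restricted-≡ c d with card (c , d) ℕ.<? card (b , e)
          ... | yes lt = trans (restricted-degree (proj₁ z) (proj₂ z) c d lt)
            (trans (degree-≡ s c d (ℕ.≤-trans lt bound)) (sym (restricted-degree (proj₁ z′) (proj₂ z′) c d lt)))
          ... | no ≮   = trans (restricted-zero (proj₁ z) (proj₂ z) c d ≮) (sym (restricted-zero (proj₁ z′) (proj₂ z′) c d ≮))
          off : ∀ a v d → ¬ (v ∈ inc (X a) d × card (a , d) ℕ.< card (b , e)) →
                ⟦ card (a , d) ℕ.<? card (b , e) ⟧ * Φ (X a) d ⁅ v ⁆ (slice a (indicators b e u)) ≡ 0ℤ
          off a v d ¬P with v ∈? inc (X a) d
          ... | no v∉  = trans (cong (⟦ card (a , d) ℕ.<? card (b , e) ⟧ *_) (Φ-outside (X a) d ⁅ v ⁆ (slice a (indicators b e u)) (x∈⁅x⁆ v) v∉))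
                           (*-zeroʳ ⟦ card (a , d) ℕ.<? card (b , e) ⟧)
          ... | yes v∈ = cong (_* Φ (X a) d ⁅ v ⁆ (slice a (indicators b e u))) (⟦⟧-false (card (a , d) ℕ.<? card (b , e)) (λ lt → ¬P (v∈ , lt)))
          small-≡ : small b e u∈ z ≡ small b e u∈ z′
          small-≡ = matching-sum
            (counts⇒matching _≈?_ ≈sym ≈trans (P? (proj₁ z) (proj₂ z)) (P? (proj₁ z′) (proj₂ z′))
              (proj₁ z ,_) (proj₁ z′ ,_) (λ (c , d) → restricted-≡ c d) ≈refl)
            (P? (proj₁ z) (proj₂ z)) (P? (proj₁ z′) (proj₂ z′)) _ _
            (λ {d} {d′} (v∈ , lt) (v′∈ , lt′) d≈d′ → cong₂ _*_
              (trans (⟦⟧-true (card (_ , d) ℕ.<? card (b , e)) lt) (sym (⟦⟧-true (card (_ , d′) ℕ.<? card (b , e)) lt′)))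
              (Φ-≈ d≈d′ v∈ v′∈ (proj₁ z~z′) b e u))
            (off (proj₁ z) (proj₂ z)) (off (proj₁ z′) (proj₂ z′))

      edge-matching : Matching (λ e → proj₂ z ∈ inc (X (proj₁ z)) e) (λ e → proj₂ z′ ∈ inc (X (proj₁ z′)) e)
                               (λ e e′ → (proj₁ z , e) ≈ (proj₁ z′ , e′))
      edge-matching = counts⇒matching _≈?_ ≈sym ≈trans (λ e → _ ∈? inc (X _) e) (λ e → _ ∈? inc (X _) e) (proj₁ z ,_) (proj₁ z′ ,_)
        (λ (b , e) → degree-≡ (suc (card (b , e))) b e ℕ.≤-refl) ≈refl

  colouring : ℕ → Colouring
  colouring zero    = trivial
  colouring (suc i) = Step.next (colouring i)

  -- Equal degrees supply the bijection for the outer multiset, between the edges at the two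
  -- vertices; equal types supply those for the inner ones, between the vertices of matched edges.
  same-colour : ∀ i {v w} → Colouring._~_ (colouring i) (false , v) (true , w) → SameColour i (X false) (X true) v w
  same-colour zero    _ = tt
  same-colour (suc i) s = mset-map {R = λ e e′ → (false , e) ≈ (true , e′)} {R′ = SameEdge (X false) (X true) i}
    (λ e≈e′ → mset-map {R = λ u u′ → (false , u) ~ (true , u′)} {R′ = SameColour i (X false) (X true)} (same-colour i)
      (matching⇒mset []=-irrelevant []=-irrelevant (≈-matching e≈e′)))
    (matching⇒mset []=-irrelevant []=-irrelevant (edge-matching s))
    where
    open Step (colouring i)
    open Colouring (colouring i)

  hom⇒not-distinguished : (∀ B → Connected B → BergeAcyclic B → Hom B (X false) ≡ Hom B (X true)) → NotDistinguished (X false) (X true)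
  hom⇒not-distinguished homs i = mset-map {R = λ u u′ → (false , u) ~ (true , u′)} {R′ = SameColour i (X false) (X true)} (same-colour i)
    (matching⇒mset (λ _ _ → refl) (λ _ _ → refl)
      (counts⇒matching _~?_ ~sym ~trans {P = λ _ → ⊤} {Q = λ _ → ⊤} (λ _ → yes tt) (λ _ → yes tt) (false ,_) (true ,_)
        (λ z → trans (sum-cong λ u → drop ((false , u) ~? z)) (trans (alg-sum homs (definable z)) (sum-cong λ u → sym (drop ((true , u) ~? z))))) ~refl))
    where
    open Colouring (colouring i)
    drop : ∀ {P : Set} (d : Dec P) → ⟦ yes tt ×-dec d ⟧ ≡ ⟦ d ⟧
    drop d = ⟦⟧-cong (yes tt ×-dec d) d proj₂ (tt ,_)

theorem1 : (G H : Hypergraph) →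
    (((B : Hypergraph) → Connected B → BergeAcyclic B → Hom B G ≡ Hom B H)
    ⇔ NotDistinguished G H)
theorem1 G H = mk⇔
  (Refinement.hom⇒not-distinguished (λ { false → G ; true → H }))
  (not-distinguished⇒hom G H)
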